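{- Let $p$ be an odd prime, let $e,r$ be integers with $e\ge 1$ and $1\le r\le p-1$, and put $m=er+(e-1)(p-r-1)+1$; assume $m\ge 3$. Let $G=\langle s_1,\dots,s_{p-1},\beta\rangle$ be the group of order $p^m$ defined by the following relations: $s_i^{p^e}=1$ for $1\le i\le r$; $s_i^{p^{e-1}}=1$ for $r+1\le i\le p-1$; $\beta^p=1$; $[s_i,s_j]=1$ for $1\le i,j\le p-1$; $s_{k+1}=[s_k,\beta]$ for $1\le k\le p-2$; and $[s_{p-1},\beta]=s_1^{ -\binom{p}{1}}s_2^{ -\binom{p}{2}}\cdots s_{p-1}^{ -\binom{p}{p-1}}$. Let $\sigma,\tau$ be the automorphisms of $G$ determined by $\sigma: s_1\mapsto s_1,\ \beta\mapsto\beta^{ -1}$ and $\tau: s_1\mapsto s_1^{ -1},\ \beta\mapsto\beta$, and let $R=G\rtimes\langle\sigma,\tau\rangle$. Then $R$ is the automorphism group of an abstract regular $3$-polytope of order $4p^m$ with type $\{p,2p\}$; equivalently, $|R|=4p^m$ and there exist involutions $\rho_0,\rho_1,\rho_2\in R$ such that $(R,\{\rho_0,\rho_1,\rho_2\})$ is a string C-group of rank $3$ and type $\{p,2p\}$.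
   Context: Conventions: $[x,y]=x^{ -1}y^{ -1}xy$ and $x^y=y^{ -1}xy$. Facts about $G$ (from the literature): $G$ has order $p^m$ and is generated by $s_1$ and $\beta$; the subgroup $A=\langle s_1,\dots,s_{p-1}\rangle$ is an abelian (normal) maximal subgroup of $G$; and every $x\in G\setminus A$ has order $p$. The assignments defining $\sigma$ and $\tau$ on the generators $s_1,\beta$ extend to automorphisms of $G$, and $\langle\sigma,\tau\rangle$ denotes the subgroup of $\mathrm{Aut}(G)$ they generate, acting naturally on $G$ in the semidirect product $R$. String C-groups: Let $H$ be a group and $S=\{\rho_0,\dots,\rho_{d-1}\}$ a generating set of $H$ consisting of involutions. For $I\subseteq\{0,\dots,d-1\}$ let $H_I=\langle\rho_i: i\in I\rangle$. The pair $(H,S)$ is a string C-group of rank $d$ if (string property) $\rho_i$ and $\rho_j$ commute whenever $|i-j|>1$, and (intersection property) $H_I\cap H_J=H_{I\cap J}$ for all $I,J\subseteq\{0,\dots,d-1\}$. Its order is $|H|$, and its (Schläfli) type is $\{p_1,\dots,p_{d-1}\}$, where $p_i$ is the order of $\rho_{i-1}\rho_i$. String C-groups of rank $d$ are the same as automorphism groups of abstract regular $d$-polytopes (with distinguished generators), with the order and type of the polytope being those of the string C-group. -}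

module Defs where

open import Algebra.Bundles using (Group; RawGroup)
open import Algebra.Morphism.Structures
  using (IsGroupHomomorphism; IsGroupIsomorphism)
import Algebra.Definitions.RawMonoid as RawMonoidDefs
import Algebra.Morphism.Construct.Composition as Comp
import Algebra.Morphism.Construct.Identity as Ident
open import Data.Fin.Base using (Fin; toℕ; inject₁)
  renaming (zero to fzero; suc to fsuc)
open import Data.Fin.Subset using (Subset; _∩_) renaming (_∈_ to _∈ₛ_)
open import Data.Nat.Base
  using (ℕ; suc; 2+; _<_; _≤_; _∸_; ∣_-_∣; NonTrivial)
  renaming (_^_ to _^ℕ_)
open import Data.Nat.Combinatorics using (_C_)
open import Data.Product.Base using (Σ-syntax; ∃-syntax; _×_; _,_; proj₁; proj₂)
open import Data.Sum.Base using (_⊎_)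
open import Data.Vec.Base using (Vec; lookup)
open import Function.Base using (_∘_; id)
open import Function.Bundles using (Bijection; _⇔_)
open import Level using (Level; _⊔_; 0ℓ)
open import Relation.Binary.PropositionalEquality as ≡ using (_≡_)
import Relation.Binary.Reasoning.Setoid as SetoidReasoning
open import Relation.Nullary.Negation using (¬_)
open import Relation.Unary using (Pred; _∈_)

private
  variable
    a b c ℓ ℓ₁ ℓ₂ q : Level

module GroupOps (G : RawGroup c ℓ) where
  open RawGroup G

  infixr 8 _^_

  _^_ : Carrier → ℕ → Carrier
  x ^ n = RawMonoidDefs._×_ rawMonoid n x

  ∏ : ∀ {n} → (Fin n → Carrier) → Carrier
  ∏ = RawMonoidDefs.sum rawMonoid

  [_,_] : Carrier → Carrier → Carrier
  [ x , y ] = x ⁻¹ ∙ y ⁻¹ ∙ x ∙ y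

  record ElementOrder (x : Carrier) (n : ℕ) : Set ℓ where
    field
      positive : 0 < n
      power    : x ^ n ≈ ε
      minimal  : ∀ k → 0 < k → k < n → ¬ (x ^ k ≈ ε)

  Involution : Carrier → Set ℓ
  Involution x = ElementOrder x 2

GroupOrder : Group c ℓ → ℕ → Set (c ⊔ ℓ)
GroupOrder G n = Bijection (≡.setoid (Fin n)) (Group.setoid G)

module _ (G : Group c ℓ) where
  open Group G

  data ⟨_⟩ (P : Pred Carrier q) : Pred Carrier (c ⊔ ℓ ⊔ q) where
    gen  : ∀ {x} → x ∈ P → x ∈ ⟨ P ⟩
    ε∈   : ε ∈ ⟨ P ⟩
    ∙∈   : ∀ {x y} → x ∈ ⟨ P ⟩ → y ∈ ⟨ P ⟩ → x ∙ y ∈ ⟨ P ⟩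
    ⁻¹∈  : ∀ {x} → x ∈ ⟨ P ⟩ → x ⁻¹ ∈ ⟨ P ⟩
    resp : ∀ {x y} → x ≈ y → x ∈ ⟨ P ⟩ → y ∈ ⟨ P ⟩

  GeneratedSubgroup : Pred Carrier q → Group (c ⊔ ℓ ⊔ q) ℓ
  GeneratedSubgroup P = record
    { Carrier = Σ[ x ∈ Carrier ] x ∈ ⟨ P ⟩
    ; _≈_     = λ x y → proj₁ x ≈ proj₁ y
    ; _∙_     = λ (x , x∈) (y , y∈) → x ∙ y , ∙∈ x∈ y∈
    ; ε       = ε , ε∈
    ; _⁻¹     = λ (x , x∈) → x ⁻¹ , ⁻¹∈ x∈
    ; isGroup = record
      { isMonoid = record
        { isSemigroup = record
          { isMagma = record
            { isEquivalence = record { refl = refl ; sym = sym ; trans = trans }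
            ; ∙-cong = ∙-cong
            }
          ; assoc = λ x y z → assoc (proj₁ x) (proj₁ y) (proj₁ z)
          }
        ; identity = identityˡ ∘ proj₁ , identityʳ ∘ proj₁
        }
      ; inverse = inverseˡ ∘ proj₁ , inverseʳ ∘ proj₁
      ; ⁻¹-cong = ⁻¹-cong
      }
    }

module _ (G : Group c ℓ) where
  open Group G

  record Automorphism : Set (c ⊔ ℓ) where
    field
      ⟦_⟧   : Carrier → Carrier
      isIso : IsGroupIsomorphism rawGroup rawGroup ⟦_⟧
    open IsGroupIsomorphism isIso public

  open Automorphism

  private
    idAut : Automorphism
    idAut = record { ⟦_⟧ = id ; isIso = Ident.isGroupIsomorphism rawGroup refl }

    compAut : Automorphism → Automorphism → Automorphism
    compAut f g = record
      { ⟦_⟧   = ⟦ f ⟧ ∘ ⟦ g ⟧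
      ; isIso = Comp.isGroupIsomorphism trans (isIso g) (isIso f)
      }

    module _ (f : Automorphism) where
      inv : Carrier → Carrier
      inv y = proj₁ (surjective f y)

      f∘inv : ∀ y → ⟦ f ⟧ (inv y) ≈ y
      f∘inv y = proj₂ (surjective f y) refl

      inv∘f : ∀ x → inv (⟦ f ⟧ x) ≈ x
      inv∘f x = injective f (f∘inv (⟦ f ⟧ x))

      inv-cong : ∀ {x y} → x ≈ y → inv x ≈ inv y
      inv-cong {x} {y} x≈y = injective f (trans (f∘inv x) (trans x≈y (sym (f∘inv y))))

      invAut : Automorphism
      invAut = record
        { ⟦_⟧   = inv
        ; isIso = record
          { isGroupMonomorphism = record
            { isGroupHomomorphism = record
              { isMonoidHomomorphism = record
                { isMagmaHomomorphism = record
                  { isRelHomomorphism = record { cong = inv-cong }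
                  ; homo = λ x y → injective f
                      (trans (f∘inv (x ∙ y))
                        (sym (trans (∙-homo f (inv x) (inv y))
                                    (∙-cong (f∘inv x) (f∘inv y)))))
                  }
                ; ε-homo = injective f (trans (f∘inv ε) (sym (ε-homo f)))
                }
              ; ⁻¹-homo = λ x → injective f
                  (trans (f∘inv (x ⁻¹))
                    (sym (trans (⁻¹-homo f (inv x)) (⁻¹-cong (f∘inv x)))))
              }
            ; injective = λ {x} {y} eq →
                trans (sym (f∘inv x)) (trans (⟦⟧-cong f eq) (f∘inv y))
            }
          ; surjective = λ x → ⟦ f ⟧ x , λ eq → trans (inv-cong eq) (inv∘f x)
          }
        }

  Aut : Group (c ⊔ ℓ) (c ⊔ ℓ)
  Aut = record
    { Carrier = Automorphism
    ; _≈_     = λ f g → ∀ x → ⟦ f ⟧ x ≈ ⟦ g ⟧ x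
    ; _∙_     = compAut
    ; ε       = idAut
    ; _⁻¹     = invAut
    ; isGroup = record
      { isMonoid = record
        { isSemigroup = record
          { isMagma = record
            { isEquivalence = record
              { refl  = λ _ → refl
              ; sym   = λ p x → sym (p x)
              ; trans = λ p r x → trans (p x) (r x)
              }
            ; ∙-cong = λ {f} {_} {_} {k} p r x → trans (⟦⟧-cong f (r x)) (p (⟦ k ⟧ x))
            }
          ; assoc = λ _ _ _ _ → refl
          }
        ; identity = (λ _ _ → refl) , (λ _ _ → refl)
        }
      ; inverse = inv∘f , f∘inv
      ; ⁻¹-cong = λ {f} {g} p x → injective f
          (trans (f∘inv f x) (sym (trans (p (inv g x)) (f∘inv g x))))
      }
    }

module _ (N : Group a ℓ₁) (H : Group b ℓ₂)
         (φ : Group.Carrier H → Automorphism N)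
         (φ-hom : IsGroupHomomorphism (Group.rawGroup H) (Group.rawGroup (Aut N)) φ)
         where
  private
    module N = Group N
    module H = Group H
    module A (h : H.Carrier) = Automorphism (φ h)
    module φ = IsGroupHomomorphism φ-hom
    act : H.Carrier → N.Carrier → N.Carrier
    act = A.⟦_⟧
    open SetoidReasoning N.setoid

  SemidirectProduct : Group (a ⊔ b) (ℓ₁ ⊔ ℓ₂)
  SemidirectProduct = record
    { Carrier = N.Carrier × H.Carrier
    ; _≈_     = λ (n , h) (n′ , h′) → n N.≈ n′ × h H.≈ h′
    ; _∙_     = λ (n , h) (n′ , h′) → n N.∙ act h n′ , h H.∙ h′
    ; ε       = N.ε , H.ε
    ; _⁻¹     = λ (n , h) → act (h H.⁻¹) (n N.⁻¹) , h H.⁻¹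
    ; isGroup = record
      { isMonoid = record
        { isSemigroup = record
          { isMagma = record
            { isEquivalence = record
              { refl  = N.refl , H.refl
              ; sym   = λ (p , r) → N.sym p , H.sym r
              ; trans = λ (p , r) (p′ , r′) → N.trans p p′ , H.trans r r′
              }
            ; ∙-cong = λ {(_ , h)} {_} {_} {(n′ , _)} (p , r) (p′ , r′) →
                N.∙-cong p (N.trans (A.⟦⟧-cong h p′) (φ.⟦⟧-cong r n′)) , H.∙-cong r r′
            }
          ; assoc = λ (n , h) (n′ , h′) (n″ , h″) →
              (begin
                n N.∙ act h n′ N.∙ act (h H.∙ h′) n″
                  ≈⟨ N.∙-congˡ (φ.homo h h′ n″) ⟩
                n N.∙ act h n′ N.∙ act h (act h′ n″)
                  ≈⟨ N.assoc n (act h n′) _ ⟩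
                n N.∙ (act h n′ N.∙ act h (act h′ n″))
                  ≈⟨ N.∙-congˡ (A.∙-homo h n′ (act h′ n″)) ⟨
                n N.∙ act h (n′ N.∙ act h′ n″) ∎)
              , H.assoc h h′ h″
          }
        ; identity =
            (λ (n , h) → N.trans (N.identityˡ _) (φ.ε-homo n) , H.identityˡ h)
          , (λ (n , h) → N.trans (N.∙-congˡ (A.ε-homo h)) (N.identityʳ n) , H.identityʳ h)
        }
      ; inverse =
          (λ (n , h) →
            (begin
              act (h H.⁻¹) (n N.⁻¹) N.∙ act (h H.⁻¹) n ≈⟨ A.∙-homo (h H.⁻¹) (n N.⁻¹) n ⟨
              act (h H.⁻¹) (n N.⁻¹ N.∙ n)              ≈⟨ A.⟦⟧-cong (h H.⁻¹) (N.inverseˡ n) ⟩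
              act (h H.⁻¹) N.ε                         ≈⟨ A.ε-homo (h H.⁻¹) ⟩
              N.ε                                      ∎)
            , H.inverseˡ h)
        , (λ (n , h) →
            (begin
              n N.∙ act h (act (h H.⁻¹) (n N.⁻¹)) ≈⟨ N.∙-congˡ (φ.homo h (h H.⁻¹) _) ⟨
              n N.∙ act (h H.∙ h H.⁻¹) (n N.⁻¹)   ≈⟨ N.∙-congˡ (φ.⟦⟧-cong (H.inverseʳ h) _) ⟩
              n N.∙ act H.ε (n N.⁻¹)              ≈⟨ N.∙-congˡ (φ.ε-homo _) ⟩
              n N.∙ n N.⁻¹                        ≈⟨ N.inverseʳ n ⟩
              N.ε                                 ∎)
            , H.inverseʳ h)
      ; ⁻¹-cong = λ {(n , h)} {(n′ , h′)} (p , r) →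
          N.trans (A.⟦⟧-cong (h H.⁻¹) (N.⁻¹-cong p)) (φ.⟦⟧-cong (H.⁻¹-cong r) _)
          , H.⁻¹-cong r
      }
    }

module _ (G : Group c ℓ) (P : Pred (Automorphism G) q) where
  private
    inclusion-hom : IsGroupHomomorphism (Group.rawGroup (GeneratedSubgroup (Aut G) P))
                                        (Group.rawGroup (Aut G)) proj₁
    inclusion-hom = record
      { isMonoidHomomorphism = record
        { isMagmaHomomorphism = record
          { isRelHomomorphism = record { cong = id }
          ; homo = λ _ _ _ → Group.refl G
          }
        ; ε-homo = λ _ → Group.refl G
        }
      ; ⁻¹-homo = λ _ _ → Group.refl G
      }

  _⋊⟨_⟩ : Group _ _
  _⋊⟨_⟩ = SemidirectProduct G (GeneratedSubgroup (Aut G) P) proj₁ inclusion-hom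

module _ (H : Group c ℓ) where
  open Group H
  open GroupOps rawGroup

  module _ {d : ℕ} (ρ : Fin d → Carrier) where

    Parabolic : Subset d → Pred Carrier (c ⊔ ℓ)
    Parabolic I = ⟨_⟩ H (λ x → ∃[ i ] i ∈ₛ I × x ≈ ρ i)

    record IsStringCGroup : Set (c ⊔ ℓ) where
      field
        involutions  : ∀ i → Involution (ρ i)
        generates    : ∀ x → x ∈ ⟨_⟩ H (λ y → ∃[ i ] y ≈ ρ i)
        string       : ∀ i j → 1 < ∣ toℕ i - toℕ j ∣ → ρ i ∙ ρ j ≈ ρ j ∙ ρ i
        intersection : ∀ (I J : Subset d) (x : Carrier) →
                       (x ∈ Parabolic I × x ∈ Parabolic J) ⇔ x ∈ Parabolic (I ∩ J)

  SchläfliType : ∀ {n} → (Fin (suc n) → Carrier) → Vec ℕ n → Set ℓ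
  SchläfliType ρ ps = ∀ i → ElementOrder (ρ (inject₁ i) ∙ ρ (fsuc i)) (lookup ps i)

module _ (X : Set) where

  infix  8 _⁻¹
  infixl 7 _∙_

  data Word : Set where
    η   : X → Word
    ε   : Word
    _∙_ : Word → Word → Word
    _⁻¹ : Word → Word

  wordRawGroup : RawGroup 0ℓ 0ℓ
  wordRawGroup = record { Carrier = Word ; _≈_ = _≡_ ; _∙_ = _∙_ ; ε = ε ; _⁻¹ = _⁻¹ }

module _ {X : Set} (Rel : Word X → Word X → Set) where

  -- The least group congruence on words containing Rel.
  data Congruence : Word X → Word X → Set where
    rel       : ∀ {x y} → Rel x y → Congruence x y
    refl      : ∀ {x} → Congruence x x
    sym       : ∀ {x y} → Congruence x y → Congruence y x
    trans     : ∀ {x y z} → Congruence x y → Congruence y z → Congruence x z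
    ∙-cong    : ∀ {x y u v} → Congruence x y → Congruence u v →
                Congruence (x ∙ u) (y ∙ v)
    ⁻¹-cong   : ∀ {x y} → Congruence x y → Congruence (x ⁻¹) (y ⁻¹)
    assoc     : ∀ x y z → Congruence (x ∙ y ∙ z) (x ∙ (y ∙ z))
    identityˡ : ∀ x → Congruence (ε ∙ x) x
    identityʳ : ∀ x → Congruence (x ∙ ε) x
    inverseˡ  : ∀ x → Congruence (x ⁻¹ ∙ x) ε
    inverseʳ  : ∀ x → Congruence (x ∙ x ⁻¹) ε

  PresentedGroup : Group 0ℓ 0ℓ
  PresentedGroup = record
    { Carrier = Word X
    ; _≈_     = Congruence
    ; _∙_     = _∙_
    ; ε       = ε
    ; _⁻¹     = _⁻¹
    ; isGroup = record
      { isMonoid = record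
        { isSemigroup = record
          { isMagma = record
            { isEquivalence = record { refl = refl ; sym = sym ; trans = trans }
            ; ∙-cong = ∙-cong
            }
          ; assoc = assoc
          }
        ; identity = identityˡ , identityʳ
        }
      ; inverse = inverseˡ , inverseʳ
      ; ⁻¹-cong = ⁻¹-cong
      }
    }

-- The generators s_1, …, s_{p-1} are indexed from 0: s i is s_{toℕ i + 1}.
data Generator (p : ℕ) : Set where
  s : Fin (p ∸ 1) → Generator p
  β : Generator p

s₁ : ∀ {p} → .{{NonTrivial p}} → Word (Generator p)
s₁ {2+ _} = η (s fzero)

module _ (p e r : ℕ) where
  open GroupOps (wordRawGroup (Generator p))

  data Relator : Word (Generator p) → Word (Generator p) → Set where
    s-power-low  : ∀ i → toℕ i < r → Relator (η (s i) ^ (p ^ℕ e)) ε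
    s-power-high : ∀ i → r ≤ toℕ i → Relator (η (s i) ^ (p ^ℕ (e ∸ 1))) ε
    β-power      : Relator (η β ^ p) ε
    s-commute    : ∀ i j → Relator [ η (s i) , η (s j) ] ε
    s-next       : ∀ i j → toℕ j ≡ suc (toℕ i) → Relator (η (s j)) [ η (s i) , η β ]
    s-last       : ∀ i → suc (toℕ i) ≡ p ∸ 1 →
                   Relator [ η (s i) , η β ]
                           (∏ λ j → (η (s j) ^ (p C suc (toℕ j))) ⁻¹)

  G : Group 0ℓ 0ℓ
  G = PresentedGroup Relator

module _ {p e r : ℕ} .{{_ : NonTrivial p}} where
  open Group (G p e r) using (_≈_)

  IsSigma : Automorphism (G p e r) → Set
  IsSigma f = ⟦ s₁ ⟧ ≈ s₁ × ⟦ η β ⟧ ≈ η β ⁻¹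
    where open Automorphism f

  IsTau : Automorphism (G p e r) → Set
  IsTau f = ⟦ s₁ ⟧ ≈ s₁ ⁻¹ × ⟦ η β ⟧ ≈ η β
    where open Automorphism f

-- Automorphisms act on the left: (g , f) ∙ (h , k) = (g ∙ f h , f ∘ k).
R : ∀ (p e r : ℕ) (σ τ : Automorphism (G p e r)) → Group 0ℓ 0ℓ
R p e r σ τ = G p e r ⋊⟨ (λ f → (f ≈ σ) ⊎ (f ≈ τ)) ⟩
  where
  open Group (Aut (G p e r)) using (_≈_)

{-# OPTIONS --safe #-}
-- A = ⟨s₁, …, s_(p-1)⟩ is ℤ[ζ]/J, where ζ is a primitive p-th root of unity, X = ζ - 1,
-- s_k corresponds to X^(k-1) and conjugation by β to T = 1 + X. The ideal J is spanned by
-- p^e X^i for i < r and p^(e-1) X^i for r ≤ i < p-1. Since 1 + T + ⋯ + T^(p-1) vanishes on A,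
-- Tᵖ = 1 and (s₁β⁻¹)ᵖ = 1. Mapping G to the holomorph of A and to ℤ/p (through the exponent
-- of β) separates the words βʲ s₁^a₁ ⋯ s_(p-1)^a_(p-1), which exhaust G; hence |G| = p^m.
-- The automorphisms σ, τ are determined by the signs they put on s₁ and β, so ⟨σ,τ⟩ has order 4.
-- With ρ₀ = s₁στ, ρ₁ = βστ, ρ₂ = σ one has ρ₀ρ₁ = s₁β⁻¹, ρ₁ρ₂ = βτ and ρ₀ρ₂ = s₁τ, and the
-- intersection property is read off from these signs and from the characters G → ℤ/p.
module Submission where

open import Defs using (module GroupOps; ⟨_⟩; gen; ε∈; ∙∈; ⁻¹∈; resp; Automorphism)
open import Algebra.Bundles using (Group; AbelianGroup)
open import Algebra.Morphism.Structures using (IsGroupHomomorphism)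
import Algebra.Morphism.Construct.Identity as Identity
import Algebra.Properties.AbelianGroup as AbelianGroupProperties
import Algebra.Properties.CommutativeSemigroup as CommutativeSemigroupProperties
import Algebra.Properties.Group as GroupProperties
import Algebra.Properties.Monoid.Mult as Mult
open import Data.Bool.Base using (Bool; true; false; not; _xor_)
open import Data.Fin.Base using (Fin; toℕ; fromℕ; fromℕ<; inject₁; combine; remQuot)
  renaming (zero to fzero; suc to fsuc)
open import Data.Fin.Induction using (<-weakInduction)
open import Data.Fin.Patterns using (0F; 1F; 2F; 3F)
import Data.Fin.Properties as Fin
open import Data.Fin.Subset using (Subset; outside; _∩_) renaming (_∈_ to _∈ₛ_)
open import Data.Fin.Subset.Properties using (p∩q⊆p; p∩q⊆q)
open import Data.Integer.Base as ℤ using (ℤ; +_; -[1+_])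
open import Data.Integer.Divisibility.Signed
  using (_∣_; divides; ∣⇒∣ᵤ; ∣ᵤ⇒∣; ∣-trans; ∣m∣n⇒∣m+n; ∣m⇒∣-m)
import Data.Integer.Properties as ℤ
open import Data.Integer.Tactic.RingSolver using (solve-∀)
open import Data.Nat.Base as ℕ
  using (ℕ; zero; suc; 2+; NonZero; _≤_; _<_; z≤n; s≤s; _∸_)
open import Data.Nat.Combinatorics
  using (_C_; nCn≡1; nC1≡n; nCk+nC[k+1]≡[n+1]C[k+1]; k>n⇒nCk≡0)
open import Data.Nat.DivMod using (_%_; _/_; m≡m%n+[m/n]*n; m%n<n)
import Data.Nat.Divisibility as ℕ∣
open import Data.Nat.Primality
  using (Prime; euclidsLemma; prime⇒nonZero; prime⇒nonTrivial; prime⇒irreducible; ¬prime[0]; ¬prime[1])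
import Data.Nat.Properties as ℕ
import Data.Nat.Tactic.RingSolver as ℕ-RingSolver
open import Data.Product.Base using (_×_; _,_; proj₁; proj₂; ∃-syntax)
open import Data.Sum.Base using (_⊎_; inj₁; inj₂)
open import Data.Vec.Base using ([]; _∷_; here; there)
open import Data.Vec.Functional using (foldr)
open import Function.Base using (_∘_; id)
open import Function.Bundles using (Bijection; mk⇔)
open import Level using (Level; 0ℓ)
open import Relation.Binary.PropositionalEquality as ≡ using (_≡_; _≢_)
import Relation.Binary.Reasoning.Setoid as SetoidReasoning
open import Relation.Nullary using (¬_; yes; no; contradiction)
open import Relation.Unary using (Pred; _∈_)

-- Throughout, p is 2+n, so that the p - 1 generators s₁, ..., s_(p-1) are indexed by `Fin (suc n)`.
-- The delicate point about A is that its coordinates have two different moduli: multiplication by X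
-- returns the last coordinate, possibly known only modulo p^(e-1), to coordinates modulo p^e. The
-- factor p in the binomial coefficients C(p,i), 0 < i < p, makes up for this. The holomorph serves
-- to read off vectors of A; the exponent of β is read off by a character, so the order of T on A is
-- never computed. Exhaustion by the normal words and their separation together let these two
-- invariants detect the identity of G. Hence (s₁β⁻¹)ᵖ = 1 is checked on vectors rather than by
-- collecting in G. In R everything is reduced to first components and pairs of signs. Oddness of p
-- enters twice: characters see a sign because 1 and -1 differ modulo p, and (βτ)ᵖ is τ rather than
-- 1, which gives both the order 2p and the generation of R.

private
  variable
    c ℓ c′ ℓ′ q : Level

-- Commutators, powers and generated subgroups in an arbitrary group

module GroupLemmas (H : Group c ℓ) where
  open Group H
  open GroupOps rawGroup
  open GroupProperties H
  open Mult monoid using (×-homo-+; ×-assocˡ; ×-congʳ)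
  open SetoidReasoning setoid

  ∙-commutator : ∀ x y → x ∙ y ≈ y ∙ (x ∙ [ x , y ])
  ∙-commutator x y = sym (begin
    y ∙ (x ∙ (x ⁻¹ ∙ y ⁻¹ ∙ x ∙ y))     ≈⟨ assoc y x _ ⟨
    y ∙ x ∙ (x ⁻¹ ∙ y ⁻¹ ∙ x ∙ y)       ≈⟨ ∙-congˡ (assoc _ x y) ⟩
    y ∙ x ∙ (x ⁻¹ ∙ y ⁻¹ ∙ (x ∙ y))     ≈⟨ ∙-congˡ (∙-congʳ (⁻¹-anti-homo-∙ y x)) ⟨
    y ∙ x ∙ ((y ∙ x) ⁻¹ ∙ (x ∙ y))      ≈⟨ \\-leftDividesˡ (y ∙ x) (x ∙ y) ⟩
    x ∙ y ∎)

  commutator-unique : ∀ {x y z} → x ∙ y ≈ y ∙ (x ∙ z) → [ x , y ] ≈ z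
  commutator-unique {x} {y} {z} eq =
    ∙-cancelˡ x _ _ (∙-cancelˡ y _ _ (trans (sym (∙-commutator x y)) eq))

  commuting⇒commutator≈ε : ∀ {x y} → x ∙ y ≈ y ∙ x → [ x , y ] ≈ ε
  commuting⇒commutator≈ε eq = commutator-unique (trans eq (∙-congˡ (sym (identityʳ _))))

  commutator≈ε⇒commuting : ∀ {x y} → [ x , y ] ≈ ε → x ∙ y ≈ y ∙ x
  commutator≈ε⇒commuting {x} {y} eq =
    trans (∙-commutator x y) (∙-congˡ (trans (∙-congˡ eq) (identityʳ x)))

  -- Stated for `y ⁻¹` because β will be represented by the inverse of the element that acts as T.
  commutator⁻¹-unique : ∀ {x y z} → y ∙ x ≈ x ∙ z ∙ y → [ x , y ⁻¹ ] ≈ z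
  commutator⁻¹-unique {x} {y} {z} eq = commutator-unique (∙-cancelˡ y _ _ (begin
    y ∙ (x ∙ y ⁻¹)         ≈⟨ assoc y x _ ⟨
    y ∙ x ∙ y ⁻¹           ≈⟨ ∙-congʳ eq ⟩
    x ∙ z ∙ y ∙ y ⁻¹       ≈⟨ //-rightDividesʳ y (x ∙ z) ⟩
    x ∙ z                  ≈⟨ \\-leftDividesˡ y (x ∙ z) ⟨
    y ∙ (y ⁻¹ ∙ (x ∙ z))   ∎))

  -- Conjugation written without inverses; with all three elements equal it says that an element
  -- commutes with its powers.
  ^-intertwine : ∀ {x y z} → x ∙ z ≈ z ∙ y → ∀ n → x ^ n ∙ z ≈ z ∙ y ^ n
  ^-intertwine eq zero = trans (identityˡ _) (sym (identityʳ _))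
  ^-intertwine {x} {y} {z} eq (suc n) = begin
    x ∙ x ^ n ∙ z    ≈⟨ assoc x _ z ⟩
    x ∙ (x ^ n ∙ z)  ≈⟨ ∙-congˡ (^-intertwine eq n) ⟩
    x ∙ (z ∙ y ^ n)  ≈⟨ assoc x z _ ⟨
    x ∙ z ∙ y ^ n    ≈⟨ ∙-congʳ eq ⟩
    z ∙ y ∙ y ^ n    ≈⟨ assoc z y _ ⟩
    z ∙ (y ∙ y ^ n)  ∎

  ∏-intertwine : ∀ {n} {f g : Fin n → Carrier} {z} → (∀ i → f i ∙ z ≈ z ∙ g i) →
                 ∏ f ∙ z ≈ z ∙ ∏ g
  ∏-intertwine {zero} eq = trans (identityˡ _) (sym (identityʳ _))
  ∏-intertwine {suc n} {f} {g} {z} eq = begin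
    f fzero ∙ ∏ (f ∘ fsuc) ∙ z    ≈⟨ assoc _ _ z ⟩
    f fzero ∙ (∏ (f ∘ fsuc) ∙ z)  ≈⟨ ∙-congˡ (∏-intertwine (eq ∘ fsuc)) ⟩
    f fzero ∙ (z ∙ ∏ (g ∘ fsuc))  ≈⟨ assoc _ z _ ⟨
    f fzero ∙ z ∙ ∏ (g ∘ fsuc)    ≈⟨ ∙-congʳ (eq fzero) ⟩
    z ∙ g fzero ∙ ∏ (g ∘ fsuc)    ≈⟨ assoc z _ _ ⟩
    z ∙ (g fzero ∙ ∏ (g ∘ fsuc))  ∎

  ∏-cong : ∀ {n} {f g : Fin n → Carrier} → (∀ i → f i ≈ g i) → ∏ f ≈ ∏ g
  ∏-cong {zero} eq = refl
  ∏-cong {suc n} eq = ∙-cong (eq fzero) (∏-cong (eq ∘ fsuc))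

  ∏-ε : ∀ {n} {f : Fin n → Carrier} → (∀ i → f i ≈ ε) → ∏ f ≈ ε
  ∏-ε {zero} eq = refl
  ∏-ε {suc n} eq = trans (∙-cong (eq fzero) (∏-ε (eq ∘ fsuc))) (identityʳ ε)

  ε^n≈ε : ∀ n → ε ^ n ≈ ε
  ε^n≈ε zero = refl
  ε^n≈ε (suc n) = trans (identityˡ _) (ε^n≈ε n)

  ^-order-* : ∀ {x N} → x ^ N ≈ ε → ∀ k → x ^ (k ℕ.* N) ≈ ε
  ^-order-* {x} {N} eq k =
    trans (sym (×-assocˡ x k N)) (trans (×-congʳ k eq) (ε^n≈ε k))

  ^-% : ∀ {x} N .{{_ : NonZero N}} → x ^ N ≈ ε → ∀ k → x ^ k ≈ x ^ (k % N)
  ^-% {x} N eq k = begin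
    x ^ k                                ≡⟨ ≡.cong (x ^_) (m≡m%n+[m/n]*n k N) ⟩
    x ^ (k % N ℕ.+ k / N ℕ.* N)          ≈⟨ ×-homo-+ x (k % N) _ ⟩
    x ^ (k % N) ∙ x ^ (k / N ℕ.* N)      ≈⟨ ∙-congˡ (^-order-* eq (k / N)) ⟩
    x ^ (k % N) ∙ ε                      ≈⟨ identityʳ _ ⟩
    x ^ (k % N)                          ∎

  -- Lets closure under products yield closure under inverses of elements of finite order.
  ⁻¹≈^ : ∀ {x} N .{{_ : NonZero N}} → x ^ N ≈ ε → x ⁻¹ ≈ x ^ ℕ.pred N
  ⁻¹≈^ {x} (suc N) eq = sym (inverseʳ-unique x (x ^ N) eq)

  ⁻¹-^ : ∀ x n → (x ⁻¹) ^ n ≈ (x ^ n) ⁻¹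
  ⁻¹-^ x n = inverseʳ-unique _ _ (go n)
    where
    go : ∀ n → x ^ n ∙ (x ⁻¹) ^ n ≈ ε
    go zero = identityʳ ε
    go (suc n) = begin
      x ∙ x ^ n ∙ (x ⁻¹ ∙ (x ⁻¹) ^ n)      ≈⟨ ∙-congʳ (^-intertwine refl n) ⟨
      x ^ n ∙ x ∙ (x ⁻¹ ∙ (x ⁻¹) ^ n)      ≈⟨ assoc _ x _ ⟩
      x ^ n ∙ (x ∙ (x ⁻¹ ∙ (x ⁻¹) ^ n))    ≈⟨ ∙-congˡ (\\-leftDividesˡ x _) ⟩
      x ^ n ∙ (x ⁻¹) ^ n                   ≈⟨ go n ⟩
      ε ∎

  ⟨⟩-mono : ∀ {q q′} {P : Pred Carrier q} {Q : Pred Carrier q′} →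
            (∀ {x} → x ∈ P → x ∈ Q) → ∀ {x} → x ∈ ⟨_⟩ H P → x ∈ ⟨_⟩ H Q
  ⟨⟩-mono f (gen x∈) = gen (f x∈)
  ⟨⟩-mono f ε∈ = ε∈
  ⟨⟩-mono f (∙∈ x∈ y∈) = ∙∈ (⟨⟩-mono f x∈) (⟨⟩-mono f y∈)
  ⟨⟩-mono f (⁻¹∈ x∈) = ⁻¹∈ (⟨⟩-mono f x∈)
  ⟨⟩-mono f (resp eq x∈) = resp eq (⟨⟩-mono f x∈)

  involution⇒⁻¹≈ : ∀ {x} → x ∙ x ≈ ε → x ⁻¹ ≈ x
  involution⇒⁻¹≈ {x} eq = sym (inverseʳ-unique x x eq)

  module _ {P : Pred Carrier q} (involutive : ∀ {x} → x ∈ P → x ∙ x ≈ ε)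
           {q′} {Q : Pred Carrier q′} (Q-resp : ∀ {x y} → x ≈ y → x ∈ Q → y ∈ Q)
           (Q-step : ∀ {x y} → x ∈ P → y ∈ Q → x ∙ y ∈ Q)
    where

    private
      -- Multiplication by `x` and by `x ⁻¹` are treated together because passing to the inverse
      -- exchanges them.
      translate : ∀ {x} → x ∈ ⟨_⟩ H P →
                  (∀ {y} → y ∈ Q → x ∙ y ∈ Q) × (∀ {y} → y ∈ Q → x ⁻¹ ∙ y ∈ Q)
      translate (gen x∈) =
        Q-step x∈ ,
        (λ y∈ → Q-resp (∙-congʳ (sym (involution⇒⁻¹≈ (involutive x∈)))) (Q-step x∈ y∈))
      translate ε∈ =
        Q-resp (sym (identityˡ _)) ,
        Q-resp (trans (sym (identityˡ _)) (∙-congʳ (sym ε⁻¹≈ε)))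
      translate (∙∈ {x} {y} x∈ y∈) with translate x∈ | translate y∈
      ... | x∙ , x⁻¹∙ | y∙ , y⁻¹∙ =
        (λ z∈ → Q-resp (sym (assoc x y _)) (x∙ (y∙ z∈))) ,
        (λ z∈ → Q-resp (trans (sym (assoc _ _ _)) (∙-congʳ (sym (⁻¹-anti-homo-∙ x y))))
                       (y⁻¹∙ (x⁻¹∙ z∈)))
      translate (⁻¹∈ {x} x∈) with translate x∈
      ... | x∙ , x⁻¹∙ =
        x⁻¹∙ , λ z∈ → Q-resp (∙-congʳ (sym (⁻¹-involutive x))) (x∙ z∈)
      translate (resp eq x∈) with translate x∈
      ... | x∙ , x⁻¹∙ =
        (λ z∈ → Q-resp (∙-congʳ eq) (x∙ z∈)) ,
        (λ z∈ → Q-resp (∙-congʳ (⁻¹-cong eq)) (x⁻¹∙ z∈))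

    -- The generators are their own inverses, so `Q` may be any set containing the identity and
    -- stable under left multiplication by generators.
    ⟨⟩-left-induction : ε ∈ Q → ∀ {x} → x ∈ ⟨_⟩ H P → x ∈ Q
    ⟨⟩-left-induction ε∈Q x∈ = Q-resp (identityʳ _) (proj₁ (translate x∈) ε∈Q)

  increment : ∀ {n} → Fin n → (Fin n → ℕ) → Fin n → ℕ
  increment fzero    a fzero    = suc (a fzero)
  increment fzero    a (fsuc i) = a (fsuc i)
  increment (fsuc k) a fzero    = a fzero
  increment (fsuc k) a (fsuc i) = increment k (a ∘ fsuc) i

  -- The new factor commutes to the left past the later powers until it meets its own.
  ∏-^-∙ : ∀ {n} {f : Fin n → Carrier} → (∀ i j → f i ∙ f j ≈ f j ∙ f i) → ∀ a k →
          ∏ (λ i → f i ^ a i) ∙ f k ≈ ∏ (λ i → f i ^ increment k a i)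
  ∏-^-∙ {f = f} f-comm a fzero = begin
    f fzero ^ a fzero ∙ rest ∙ f fzero      ≈⟨ assoc _ _ _ ⟩
    f fzero ^ a fzero ∙ (rest ∙ f fzero)    ≈⟨ ∙-congˡ (∏-intertwine λ i →
                                                 ^-intertwine (f-comm (fsuc i) fzero) (a (fsuc i))) ⟩
    f fzero ^ a fzero ∙ (f fzero ∙ rest)    ≈⟨ assoc _ _ _ ⟨
    f fzero ^ a fzero ∙ f fzero ∙ rest      ≈⟨ ∙-congʳ (^-intertwine refl (a fzero)) ⟩
    f fzero ∙ f fzero ^ a fzero ∙ rest      ∎
    where rest = ∏ (λ i → f (fsuc i) ^ a (fsuc i))
  ∏-^-∙ f-comm a (fsuc k) =
    trans (assoc _ _ _) (∙-congˡ (∏-^-∙ (λ i j → f-comm (fsuc i) (fsuc j)) (a ∘ fsuc) k))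

-- Homomorphisms: powers, products and agreement on generators

module _ {G : Group c ℓ} {H : Group c′ ℓ′} {φ : Group.Carrier G → Group.Carrier H}
         (φ-hom : IsGroupHomomorphism (Group.rawGroup G) (Group.rawGroup H) φ) where
  private
    module G = Group G
    module G^ = GroupOps G.rawGroup
    module H = Group H
    module H^ = GroupOps H.rawGroup
    module φ = IsGroupHomomorphism φ-hom

  ^-homo : ∀ x n → φ (x G^.^ n) H.≈ φ x H^.^ n
  ^-homo x zero = φ.ε-homo
  ^-homo x (suc n) = H.trans (φ.homo _ _) (H.∙-congˡ (^-homo x n))

  ∏-homo : ∀ {n} (f : Fin n → G.Carrier) → φ (G^.∏ f) H.≈ H^.∏ (φ ∘ f)
  ∏-homo {zero} f = φ.ε-homo
  ∏-homo {suc n} f = H.trans (φ.homo _ _) (H.∙-congˡ (∏-homo (f ∘ fsuc)))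

  module _ {ψ : G.Carrier → H.Carrier}
           (ψ-hom : IsGroupHomomorphism G.rawGroup H.rawGroup ψ) where
    private module ψ = IsGroupHomomorphism ψ-hom

    homo-agree : ∀ {q} {P : Pred G.Carrier q} → (∀ {x} → x ∈ P → φ x H.≈ ψ x) →
                 ∀ {x} → x ∈ ⟨_⟩ G P → φ x H.≈ ψ x
    homo-agree eq (gen x∈) = eq x∈
    homo-agree eq ε∈ = H.trans φ.ε-homo (H.sym ψ.ε-homo)
    homo-agree eq (∙∈ x∈ y∈) = H.trans (φ.homo _ _)
      (H.trans (H.∙-cong (homo-agree eq x∈) (homo-agree eq y∈)) (H.sym (ψ.homo _ _)))
    homo-agree eq (⁻¹∈ x∈) = H.trans (φ.⁻¹-homo _)
      (H.trans (H.⁻¹-cong (homo-agree eq x∈)) (H.sym (ψ.⁻¹-homo _)))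
    homo-agree eq (resp x≈y x∈) = H.trans (φ.⟦⟧-cong (G.sym x≈y))
      (H.trans (homo-agree eq x∈) (ψ.⟦⟧-cong x≈y))

mkGroupHom : {G : Group c ℓ} {H : Group c′ ℓ′} (φ : Group.Carrier G → Group.Carrier H) →
             (∀ {x y} → Group._≈_ G x y → Group._≈_ H (φ x) (φ y)) →
             (∀ x y → Group._≈_ H (φ (Group._∙_ G x y)) (Group._∙_ H (φ x) (φ y))) →
             IsGroupHomomorphism (Group.rawGroup G) (Group.rawGroup H) φ
mkGroupHom {G = G} {H = H} φ φ-cong φ-homo = record
  { isMonoidHomomorphism = record
    { isMagmaHomomorphism = record
      { isRelHomomorphism = record { cong = φ-cong }
      ; homo = φ-homo
      }
    ; ε-homo = φε≈ε
    }
  ; ⁻¹-homo = λ x → GroupProperties.inverseʳ-unique H (φ x) (φ (x G.⁻¹))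
      (H.trans (H.sym (φ-homo x (x G.⁻¹))) (H.trans (φ-cong (G.inverseʳ x)) φε≈ε))
  }
  where
  module G = Group G
  module H = Group H
  φε≈ε : φ G.ε H.≈ H.ε
  φε≈ε = GroupProperties.∙-cancelˡ H (φ G.ε) _ _
    (H.trans (H.sym (φ-homo G.ε G.ε))
             (H.trans (φ-cong (G.identityʳ G.ε)) (H.sym (H.identityʳ _))))

-- The operator T = 1 + X on a multiplicatively written abelian group

module UnipotentOperator (M : AbelianGroup c ℓ) (X : AbelianGroup.Carrier M → AbelianGroup.Carrier M)
  (X-hom : IsGroupHomomorphism (AbelianGroup.rawGroup M) (AbelianGroup.rawGroup M) X) where
  open AbelianGroup M
  open GroupOps rawGroup
  open GroupLemmas group
  open GroupProperties group using (ε⁻¹≈ε)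
  open AbelianGroupProperties M using (⁻¹-∙-comm)
  open CommutativeSemigroupProperties commutativeSemigroup
    using (interchange)
  open Mult monoid using (×-homo-+; ×-homo-1; ×-congʳ)
  open SetoidReasoning setoid
  private module X = IsGroupHomomorphism X-hom

  T : Carrier → Carrier
  T v = v ∙ X v

  T-cong : ∀ {v w} → v ≈ w → T v ≈ T w
  T-cong eq = ∙-cong eq (X.⟦⟧-cong eq)

  T-homo : ∀ v w → T (v ∙ w) ≈ T v ∙ T w
  T-homo v w = trans (∙-congˡ (X.homo v w)) (interchange v w (X v) (X w))

  X-T : ∀ v → X (T v) ≈ T (X v)
  X-T v = X.homo v (X v)

  T^ : ℕ → Carrier → Carrier
  T^ zero    v = v
  T^ (suc n) v = T (T^ n v)

  -- The geometric sum 1 + T + ⋯ + Tⁿ⁻¹ in Horner form.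
  geometric : ℕ → Carrier → Carrier
  geometric zero    v = ε
  geometric (suc n) v = v ∙ T (geometric n v)

  geometric-cong : ∀ n {v w} → v ≈ w → geometric n v ≈ geometric n w
  geometric-cong zero    eq = refl
  geometric-cong (suc n) eq = ∙-cong eq (T-cong (geometric-cong n eq))

  geometric-homo : ∀ n v w → geometric n (v ∙ w) ≈ geometric n v ∙ geometric n w
  geometric-homo zero    v w = sym (identityʳ ε)
  geometric-homo (suc n) v w = begin
    v ∙ w ∙ T (geometric n (v ∙ w))            ≈⟨ ∙-congˡ (T-cong (geometric-homo n v w)) ⟩
    v ∙ w ∙ T (geometric n v ∙ geometric n w)          ≈⟨ ∙-congˡ (T-homo _ _) ⟩
    v ∙ w ∙ (T (geometric n v) ∙ T (geometric n w))    ≈⟨ interchange v w _ _ ⟩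
    v ∙ T (geometric n v) ∙ (w ∙ T (geometric n w))    ∎

  geometric-X : ∀ n v → geometric n (X v) ≈ X (geometric n v)
  geometric-X zero    v = sym X.ε-homo
  geometric-X (suc n) v = begin
    X v ∙ T (geometric n (X v))    ≈⟨ ∙-congˡ (T-cong (geometric-X n v)) ⟩
    X v ∙ T (X (geometric n v))    ≈⟨ ∙-congˡ (X-T _) ⟨
    X v ∙ X (T (geometric n v))    ≈⟨ X.homo _ _ ⟨
    X (v ∙ T (geometric n v))      ∎

  -- The telescoping identity Tⁿ - 1 = (T - 1)(1 + T + ⋯ + Tⁿ⁻¹), with T - 1 = X.
  T^≈1+X·geometric : ∀ n v → T^ n v ≈ v ∙ X (geometric n v)
  T^≈1+X·geometric zero    v = trans (sym (identityʳ v)) (∙-congˡ (sym X.ε-homo))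
  T^≈1+X·geometric (suc n) v = begin
    T (T^ n v)                   ≈⟨ T-cong (T^≈1+X·geometric n v) ⟩
    T (v ∙ X (geometric n v))            ≈⟨ T-homo v _ ⟩
    v ∙ X v ∙ T (X (geometric n v))      ≈⟨ ∙-congˡ (X-T _) ⟨
    v ∙ X v ∙ X (T (geometric n v))      ≈⟨ assoc v _ _ ⟩
    v ∙ (X v ∙ X (T (geometric n v)))    ≈⟨ ∙-congˡ (X.homo _ _) ⟨
    v ∙ X (v ∙ T (geometric n v))        ∎

  -- The first f terms of Σ_j C(n, k + j) Xʲ v.
  binomialSum : (f n k : ℕ) → Carrier → Carrier
  binomialSum zero    n k v = ε
  binomialSum (suc f) n k v = v ^ (n C k) ∙ binomialSum f n (suc k) (X v)

  binomialSum-cong : ∀ f n k {v w} → v ≈ w → binomialSum f n k v ≈ binomialSum f n k w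
  binomialSum-cong zero    n k eq = refl
  binomialSum-cong (suc f) n k eq =
    ∙-cong (×-congʳ (n C k) eq) (binomialSum-cong f n (suc k) (X.⟦⟧-cong eq))

  binomialSum-pascal : ∀ f n k v →
    binomialSum f (suc n) (suc k) v ≈ binomialSum f n k v ∙ binomialSum f n (suc k) v
  binomialSum-pascal zero    n k v = sym (identityʳ ε)
  binomialSum-pascal (suc f) n k v = begin
    v ^ (suc n C suc k) ∙ binomialSum f (suc n) (2+ k) (X v)
      ≈⟨ ∙-cong (reflexive (≡.cong (v ^_) (≡.sym (nCk+nC[k+1]≡[n+1]C[k+1] n k))))
                (binomialSum-pascal f n (suc k) (X v)) ⟩
    v ^ (n C k ℕ.+ n C suc k) ∙ (binomialSum f n (suc k) (X v) ∙ binomialSum f n (2+ k) (X v))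
      ≈⟨ ∙-congʳ (×-homo-+ v (n C k) (n C suc k)) ⟩
    v ^ (n C k) ∙ v ^ (n C suc k) ∙ (binomialSum f n (suc k) (X v) ∙ binomialSum f n (2+ k) (X v))
      ≈⟨ interchange _ _ _ _ ⟩
    binomialSum (suc f) n k v ∙ binomialSum (suc f) n (suc k) v ∎

  binomialSum-0 : ∀ f k v → binomialSum f 0 (suc k) v ≈ ε
  binomialSum-0 zero    k v = refl
  binomialSum-0 (suc f) k v =
    trans (∙-cong (reflexive (≡.cong (v ^_) (k>n⇒nCk≡0 {0} {suc k} ℕ.z<s))) (binomialSum-0 f (suc k) (X v)))
          (identityʳ ε)

  -- Both sides are ((1 + X)ⁿ - 1) / X. The slack `g` admits trailing zero terms: in the induction
  -- step Pascal's rule leaves two sums for `n`, one with slack `g` after its constant term is split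
  -- off and one with slack `suc g`.
  geometric≈binomialSum : ∀ n g v → geometric n v ≈ binomialSum (n ℕ.+ g) n 1 v
  geometric≈binomialSum zero    g v = sym (binomialSum-0 g 0 v)
  geometric≈binomialSum (suc n) g v = sym (begin
    binomialSum (suc (n ℕ.+ g)) (suc n) 1 v
      ≈⟨ binomialSum-pascal (suc (n ℕ.+ g)) n 0 v ⟩
    v ^ (n C 0) ∙ binomialSum (n ℕ.+ g) n 1 (X v) ∙ binomialSum (suc (n ℕ.+ g)) n 1 v
      ≈⟨ ∙-cong (∙-cong (×-homo-1 v) (trans (sym (geometric≈binomialSum n g (X v))) (geometric-X n v)))
                (trans (reflexive (≡.cong (λ f → binomialSum f n 1 v) (≡.sym (ℕ.+-suc n g))))
                       (sym (geometric≈binomialSum n (suc g) v))) ⟩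
    v ∙ X (geometric n v) ∙ geometric n v
      ≈⟨ assoc v _ _ ⟩
    v ∙ (X (geometric n v) ∙ geometric n v)
      ≈⟨ ∙-congˡ (comm _ _) ⟩
    v ∙ T (geometric n v) ∎)

  -- The last of the 2+n terms is kept apart, since X applied to `d (fromℕ n)` is no longer a member
  -- of the family `d`.
  binomialSum-basis : ∀ n (d : Fin (suc n) → Carrier) →
    (∀ k → X (d (inject₁ k)) ≈ d (fsuc k)) → ∀ N k →
    binomialSum (2+ n) N k (d fzero) ≈
      ∏ (λ j → d j ^ (N C (k ℕ.+ toℕ j))) ∙ X (d (fromℕ n)) ^ (N C (k ℕ.+ suc n))
  binomialSum-basis zero d X-next N k = begin
    d fzero ^ (N C k) ∙ (X (d fzero) ^ (N C suc k) ∙ ε)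
      ≈⟨ ∙-congˡ (identityʳ _) ⟩
    d fzero ^ (N C k) ∙ X (d fzero) ^ (N C suc k)
      ≡⟨ ≡.cong₂ (λ i j → d fzero ^ (N C i) ∙ X (d fzero) ^ (N C j))
                 (≡.sym (ℕ.+-identityʳ k)) (≡.sym (ℕ.+-comm k 1)) ⟩
    d fzero ^ (N C (k ℕ.+ 0)) ∙ X (d fzero) ^ (N C (k ℕ.+ 1))
      ≈⟨ ∙-congʳ (identityʳ _) ⟨
    d fzero ^ (N C (k ℕ.+ 0)) ∙ ε ∙ X (d fzero) ^ (N C (k ℕ.+ 1)) ∎
  binomialSum-basis (suc n) d X-next N k = begin
    d fzero ^ (N C k) ∙ binomialSum (2+ n) N (suc k) (X (d fzero))
      ≈⟨ ∙-congˡ (binomialSum-cong (2+ n) N (suc k) (X-next fzero)) ⟩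
    d fzero ^ (N C k) ∙ binomialSum (2+ n) N (suc k) (d (fsuc fzero))
      ≈⟨ ∙-congˡ (binomialSum-basis n (d ∘ fsuc) (X-next ∘ fsuc) N (suc k)) ⟩
    d fzero ^ (N C k) ∙ (∏ (λ j → d (fsuc j) ^ (N C suc (k ℕ.+ toℕ j)))
                         ∙ X (d (fromℕ (suc n))) ^ (N C suc (k ℕ.+ suc n)))
      ≈⟨ assoc _ _ _ ⟨
    d fzero ^ (N C k) ∙ ∏ (λ j → d (fsuc j) ^ (N C suc (k ℕ.+ toℕ j)))
                         ∙ X (d (fromℕ (suc n))) ^ (N C suc (k ℕ.+ suc n))
      ≈⟨ ∙-cong (∙-cong (exponent (≡.sym (ℕ.+-identityʳ k)))
                        (∏-cong {suc n} (λ j → exponent {d (fsuc j)} (≡.sym (ℕ.+-suc k (toℕ j))))))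
                (exponent (≡.sym (ℕ.+-suc k (suc n)))) ⟩
    ∏ (λ j → d j ^ (N C (k ℕ.+ toℕ j))) ∙ X (d (fromℕ (suc n))) ^ (N C (k ℕ.+ 2+ n)) ∎
    where
    exponent : ∀ {v i j} → i ≡ j → v ^ (N C i) ≈ v ^ (N C j)
    exponent ≡.refl = refl

  ∏-⁻¹ : ∀ {n} (f : Fin n → Carrier) → ∏ (λ i → f i ⁻¹) ≈ ∏ f ⁻¹
  ∏-⁻¹ {zero}  f = sym ε⁻¹≈ε
  ∏-⁻¹ {suc n} f = trans (∙-congˡ (∏-⁻¹ (f ∘ fsuc))) (⁻¹-∙-comm _ _)

  -- With X = ζ - 1, the hypotheses say that d is the basis 1, X, …, X^(p-2) of ℤ[ζ] and
  -- that X satisfies ((1 + X)^p - 1) / X = 0.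
  module Cyclotomic (n : ℕ) (d : Fin (suc n) → Carrier)
    (X-next : ∀ k → X (d (inject₁ k)) ≈ d (fsuc k))
    (X-last : X (d (fromℕ n)) ≈ ∏ (λ j → (d j ^ (2+ n C suc (toℕ j))) ⁻¹))
    (generating : ∀ v → v ∈ ⟨_⟩ group (λ w → ∃[ i ] w ≈ d i)) where

    -- The binomial form of the sum is the defining relation of ζ - 1: its leading coefficient
    -- C(p,p) is 1, and `X-last` equates the leading term with the negative of all the others.
    geometric-d₀ : geometric (2+ n) (d fzero) ≈ ε
    geometric-d₀ = begin
      geometric (2+ n) (d fzero)
        ≈⟨ geometric≈binomialSum (2+ n) 0 (d fzero) ⟩
      binomialSum (2+ n ℕ.+ 0) (2+ n) 1 (d fzero)
        ≡⟨ ≡.cong (λ f → binomialSum f (2+ n) 1 (d fzero)) (ℕ.+-identityʳ (2+ n)) ⟩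
      binomialSum (2+ n) (2+ n) 1 (d fzero)
        ≈⟨ binomialSum-basis n d X-next (2+ n) 1 ⟩
      ∏ relation ∙ X (d (fromℕ n)) ^ (2+ n C 2+ n)
        ≡⟨ ≡.cong (λ i → ∏ relation ∙ X (d (fromℕ n)) ^ i) (nCn≡1 (2+ n)) ⟩
      ∏ relation ∙ X (d (fromℕ n)) ^ 1
        ≈⟨ ∙-congˡ (trans (×-homo-1 _) (trans X-last (∏-⁻¹ relation))) ⟩
      ∏ relation ∙ ∏ relation ⁻¹
        ≈⟨ inverseʳ _ ⟩
      ε ∎
      where
      relation : Fin (suc n) → Carrier
      relation j = d j ^ (2+ n C suc (toℕ j))

    -- The geometric sum commutes with X, so its vanishing passes from each basis vector to the
    -- next.
    geometric-d : ∀ i → geometric (2+ n) (d i) ≈ ε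
    geometric-d = <-weakInduction (λ i → geometric (2+ n) (d i) ≈ ε) geometric-d₀ (λ i eq → begin
      geometric (2+ n) (d (fsuc i))          ≈⟨ geometric-cong (2+ n) (X-next i) ⟨
      geometric (2+ n) (X (d (inject₁ i)))   ≈⟨ geometric-X (2+ n) _ ⟩
      X (geometric (2+ n) (d (inject₁ i)))   ≈⟨ X.⟦⟧-cong eq ⟩
      X ε                            ≈⟨ X.ε-homo ⟩
      ε                              ∎)

    geometric≈ε : ∀ v → geometric (2+ n) v ≈ ε
    geometric≈ε v = homo-agree {G = group} {H = group}
      (mkGroupHom {G = group} {H = group} (geometric (2+ n)) (geometric-cong (2+ n)) (geometric-homo (2+ n)))
      (mkGroupHom {G = group} {H = group} (λ _ → ε) (λ _ → refl) (λ _ _ → sym (identityʳ ε)))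
      (λ (i , eq) → trans (geometric-cong (2+ n) eq) (geometric-d i)) (generating v)

    T^≈id : ∀ v → T^ (2+ n) v ≈ v
    T^≈id v = begin
      T^ (2+ n) v          ≈⟨ T^≈1+X·geometric (2+ n) v ⟩
      v ∙ X (geometric (2+ n) v)   ≈⟨ ∙-congˡ (X.⟦⟧-cong (geometric≈ε v)) ⟩
      v ∙ X ε              ≈⟨ ∙-congˡ X.ε-homo ⟩
      v ∙ ε                ≈⟨ identityʳ v ⟩
      v                    ∎

    -- Since Tᵖ = 1, the inverse of T is T^(p-1), and p - 1 is `suc n`.
    T-automorphism : Automorphism group
    T-automorphism = record
      { ⟦_⟧ = T
      ; isIso = record
        { isGroupMonomorphism = record
          { isGroupHomomorphism = mkGroupHom {G = group} {H = group} T T-cong T-homo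
          ; injective = λ {v} {w} eq →
              trans (sym (inverse-T v)) (trans (T^-cong (suc n) eq) (inverse-T w))
          }
        ; surjective = λ v → T^ (suc n) v , λ eq → trans (T-cong eq) (T^≈id v)
        }
      }
      where
      T^-cong : ∀ m {v w} → v ≈ w → T^ m v ≈ T^ m w
      T^-cong zero    eq = eq
      T^-cong (suc m) eq = T-cong (T^-cong m eq)
      T^-T : ∀ m v → T^ m (T v) ≈ T (T^ m v)
      T^-T zero    v = refl
      T^-T (suc m) v = T-cong (T^-T m v)
      inverse-T : ∀ v → T^ (suc n) (T v) ≈ v
      inverse-T v = trans (T^-T (suc n) v) (T^≈id v)

open import Defs

-- Evaluation of words and homomorphisms out of a presented group

module Lift {X : Set} (Rel : Word X → Word X → Set) (H : Group c ℓ)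
            (f : X → Group.Carrier H) where
  open Group H using (Carrier; _≈_) renaming (_∙_ to _∙ᴴ_; _⁻¹ to _⁻¹ᴴ; ε to εᴴ)
  private
    module H = Group H
    module W^ = GroupOps (wordRawGroup X)
    module H^ = GroupOps H.rawGroup

  lift : Word X → Carrier
  lift (η x)   = f x
  lift ε       = εᴴ
  lift (x ∙ y) = lift x ∙ᴴ lift y
  lift (x ⁻¹)  = lift x ⁻¹ᴴ

  lift-^ : ∀ x n → lift (x W^.^ n) ≡ lift x H^.^ n
  lift-^ x zero = ≡.refl
  lift-^ x (suc n) = ≡.cong (lift x ∙ᴴ_) (lift-^ x n)

  lift-∏ : ∀ {n} (g : Fin n → Word X) → lift (W^.∏ g) ≡ H^.∏ (lift ∘ g)
  lift-∏ {zero} g = ≡.refl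
  lift-∏ {suc n} g = ≡.cong (lift (g fzero) ∙ᴴ_) (lift-∏ (g ∘ fsuc))

  module _ (respects : ∀ {x y} → Rel x y → lift x ≈ lift y) where

    lift-cong : ∀ {x y} → Congruence Rel x y → lift x ≈ lift y
    lift-cong (rel r) = respects r
    lift-cong refl = H.refl
    lift-cong (sym p) = H.sym (lift-cong p)
    lift-cong (trans p q) = H.trans (lift-cong p) (lift-cong q)
    lift-cong (∙-cong p q) = H.∙-cong (lift-cong p) (lift-cong q)
    lift-cong (⁻¹-cong p) = H.⁻¹-cong (lift-cong p)
    lift-cong (assoc x y z) = H.assoc _ _ _
    lift-cong (identityˡ x) = H.identityˡ _
    lift-cong (identityʳ x) = H.identityʳ _
    lift-cong (inverseˡ x) = H.inverseˡ _
    lift-cong (inverseʳ x) = H.inverseʳ _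

    lift-isGroupHomomorphism :
      IsGroupHomomorphism (Group.rawGroup (PresentedGroup Rel)) H.rawGroup lift
    lift-isGroupHomomorphism =
      mkGroupHom {G = PresentedGroup Rel} {H = H} lift lift-cong (λ _ _ → H.refl)

-- Integers modulo m and products of abelian groups

infix 4 _≡_[mod_]

-- A record, so that the two sides can be inferred from a proof.
record _≡_[mod_] (x y : ℤ) (m : ℕ) : Set where
  constructor congruent
  field difference : + m ∣ x ℤ.- y

module _ {m : ℕ} where

  ≡⇒≡mod : ∀ {x y} → x ≡ y → x ≡ y [mod m ]
  ≡⇒≡mod {x} ≡.refl = congruent (divides (+ 0) (ℤ.+-inverseʳ x))

  ≡mod-sym : ∀ {x y} → x ≡ y [mod m ] → y ≡ x [mod m ]
  ≡mod-sym {x} {y} (congruent d) = congruent (≡.subst (+ m ∣_) (lem x y) (∣m⇒∣-m d))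
    where
    lem : ∀ x y → ℤ.- (x ℤ.- y) ≡ y ℤ.- x
    lem = solve-∀

  ≡mod-trans : ∀ {x y z} → x ≡ y [mod m ] → y ≡ z [mod m ] → x ≡ z [mod m ]
  ≡mod-trans {x} {y} {z} (congruent d) (congruent d′) =
    congruent (≡.subst (+ m ∣_) (lem x y z) (∣m∣n⇒∣m+n d d′))
    where
    lem : ∀ x y z → (x ℤ.- y) ℤ.+ (y ℤ.- z) ≡ x ℤ.- z
    lem = solve-∀

  +-cong-mod : ∀ {x y u v} → x ≡ y [mod m ] → u ≡ v [mod m ] → x ℤ.+ u ≡ y ℤ.+ v [mod m ]
  +-cong-mod {x} {y} {u} {v} (congruent d) (congruent d′) =
    congruent (≡.subst (+ m ∣_) (lem x y u v) (∣m∣n⇒∣m+n d d′))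
    where
    lem : ∀ x y u v → (x ℤ.- y) ℤ.+ (u ℤ.- v) ≡ (x ℤ.+ u) ℤ.- (y ℤ.+ v)
    lem = solve-∀

  -‿cong-mod : ∀ {x y} → x ≡ y [mod m ] → ℤ.- x ≡ ℤ.- y [mod m ]
  -‿cong-mod {x} {y} (congruent d) = congruent (≡.subst (+ m ∣_) (lem x y) (∣m⇒∣-m d))
    where
    lem : ∀ x y → ℤ.- (x ℤ.- y) ≡ ℤ.- x ℤ.- (ℤ.- y)
    lem = solve-∀

  ≡0mod : ∀ {x} → + m ∣ x → x ≡ + 0 [mod m ]
  ≡0mod {x} d = congruent (≡.subst (+ m ∣_) (≡.sym (ℤ.+-identityʳ x)) d)

  ≡mod⇒∣ : ∀ {x y} → x ≡ y [mod m ] → m ℕ∣.∣ ℤ.∣ x ℤ.- y ∣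
  ≡mod⇒∣ (congruent d) = ∣⇒∣ᵤ d

ℤmod : ℕ → AbelianGroup 0ℓ 0ℓ
ℤmod m = record
  { Carrier = ℤ
  ; _≈_ = _≡_[mod m ]
  ; _∙_ = ℤ._+_
  ; ε = + 0
  ; _⁻¹ = ℤ.-_
  ; isAbelianGroup = record
    { isGroup = record
      { isMonoid = record
        { isSemigroup = record
          { isMagma = record
            { isEquivalence = record
              { refl = ≡⇒≡mod ≡.refl ; sym = ≡mod-sym ; trans = ≡mod-trans }
            ; ∙-cong = +-cong-mod
            }
          ; assoc = λ x y z → ≡⇒≡mod (ℤ.+-assoc x y z)
          }
        ; identity = (λ x → ≡⇒≡mod (ℤ.+-identityˡ x)) , (λ x → ≡⇒≡mod (ℤ.+-identityʳ x))
        }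
      ; inverse = (λ x → ≡⇒≡mod (ℤ.+-inverseˡ x)) , (λ x → ≡⇒≡mod (ℤ.+-inverseʳ x))
      ; ⁻¹-cong = -‿cong-mod
      }
    ; comm = λ x y → ≡⇒≡mod (ℤ.+-comm x y)
    }
  }

ΠAbelian : {I : Set} → (I → AbelianGroup c ℓ) → AbelianGroup c ℓ
ΠAbelian {I = I} A = record
  { Carrier = ∀ i → A.Carrier i
  ; _≈_ = λ x y → ∀ i → A._≈_ i (x i) (y i)
  ; _∙_ = λ x y i → A._∙_ i (x i) (y i)
  ; ε = λ i → A.ε i
  ; _⁻¹ = λ x i → A._⁻¹ i (x i)
  ; isAbelianGroup = record
    { isGroup = record
      { isMonoid = record
        { isSemigroup = record
          { isMagma = record
            { isEquivalence = record
              { refl = λ i → A.refl i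
              ; sym = λ p i → A.sym i (p i)
              ; trans = λ p q i → A.trans i (p i) (q i)
              }
            ; ∙-cong = λ p q i → A.∙-cong i (p i) (q i)
            }
          ; assoc = λ x y z i → A.assoc i (x i) (y i) (z i)
          }
        ; identity = (λ x i → A.identityˡ i (x i)) , (λ x i → A.identityʳ i (x i))
        }
      ; inverse = (λ x i → A.inverseˡ i (x i)) , (λ x i → A.inverseʳ i (x i))
      ; ⁻¹-cong = λ p i → A.⁻¹-cong i (p i)
      }
    ; comm = λ x y i → A.comm i (x i) (y i)
    }
  }
  where module A (i : I) = AbelianGroup (A i)

-- Congruences and binomial coefficients

absorption : ∀ n k → suc k ℕ.* (suc n C suc k) ≡ suc n ℕ.* (n C k)
absorption n zero = ≡.trans (≡.cong (1 ℕ.*_) (nC1≡n (suc n))) (ℕ.*-comm 1 (suc n))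
absorption zero (suc k) = ≡.trans (≡.cong (2+ k ℕ.*_) (k>n⇒nCk≡0 {1} {2+ k} (s≤s ℕ.z<s)))
  (≡.trans (ℕ.*-zeroʳ (2+ k)) (≡.sym (≡.cong (1 ℕ.*_) (k>n⇒nCk≡0 {0} {suc k} ℕ.z<s))))
absorption (suc n) (suc k) = begin
  2+ k ℕ.* (2+ n C 2+ k)
    ≡⟨ ≡.cong (2+ k ℕ.*_) (nCk+nC[k+1]≡[n+1]C[k+1] (suc n) (suc k)) ⟨
  2+ k ℕ.* (a ℕ.+ b)
    ≡⟨ ℕ.*-distribˡ-+ (2+ k) a b ⟩
  a ℕ.+ suc k ℕ.* a ℕ.+ 2+ k ℕ.* b
    ≡⟨ ≡.cong₂ (λ x y → a ℕ.+ x ℕ.+ y) (absorption n k) (absorption n (suc k)) ⟩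
  a ℕ.+ suc n ℕ.* (n C k) ℕ.+ suc n ℕ.* (n C suc k)
    ≡⟨ ℕ.+-assoc a _ _ ⟩
  a ℕ.+ (suc n ℕ.* (n C k) ℕ.+ suc n ℕ.* (n C suc k))
    ≡⟨ ≡.cong (a ℕ.+_) (ℕ.*-distribˡ-+ (suc n) (n C k) (n C suc k)) ⟨
  a ℕ.+ suc n ℕ.* (n C k ℕ.+ n C suc k)
    ≡⟨ ≡.cong (λ x → a ℕ.+ suc n ℕ.* x) (nCk+nC[k+1]≡[n+1]C[k+1] n k) ⟩
  2+ n ℕ.* (suc n C suc k) ∎
  where
  open ≡.≡-Reasoning
  a = suc n C suc k
  b = suc n C 2+ k

-- By `absorption` the prime divides (k + 1) · C(p + 1, k + 1), and k + 1 is too small to be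
-- divisible by it.
prime∣binomial : ∀ {p} → Prime (suc p) → ∀ {k} → k < p → suc p ℕ∣.∣ (suc p C suc k)
prime∣binomial {p} pp {k} k<p
  with euclidsLemma (suc k) (suc p C suc k) pp
         (ℕ∣.divides (p C k) (≡.trans (absorption p k) (ℕ.*-comm (suc p) (p C k))))
... | inj₁ p∣k = contradiction p∣k (ℕ∣.>⇒∤ (s≤s k<p))
... | inj₂ p∣C = p∣C

≡mod-weaken : ∀ {m k x y} → m ℕ∣.∣ k → x ≡ y [mod k ] → x ≡ y [mod m ]
≡mod-weaken m∣k (congruent d) = congruent (∣-trans (∣ᵤ⇒∣ m∣k) d)

-- The modulus may grow by as much as the factor `a`. The term of X that wraps around from the last
-- coordinate depends on this gain.
*-cong-mod : ∀ {m m′ a x y} → m′ ℕ∣.∣ a ℕ.* m → x ≡ y [mod m ] → + a ℤ.* x ≡ + a ℤ.* y [mod m′ ]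
*-cong-mod {m} {m′} {a} {x} {y} m′∣am (congruent (divides k eq)) = congruent
  (∣-trans (∣ᵤ⇒∣ m′∣am) (divides k (begin
    + a ℤ.* x ℤ.- + a ℤ.* y      ≡⟨ factor (+ a) x y ⟩
    + a ℤ.* (x ℤ.- y)            ≡⟨ ≡.cong (+ a ℤ.*_) eq ⟩
    + a ℤ.* (k ℤ.* + m)          ≡⟨ swap (+ a) k (+ m) ⟩
    k ℤ.* (+ a ℤ.* + m)          ≡⟨ ≡.cong (k ℤ.*_) (ℤ.pos-* a m) ⟨
    k ℤ.* + (a ℕ.* m)            ∎)))
  where
  open ≡.≡-Reasoning
  factor : ∀ a x y → a ℤ.* x ℤ.- a ℤ.* y ≡ a ℤ.* (x ℤ.- y)
  factor = solve-∀
  swap : ∀ a k m → a ℤ.* (k ℤ.* m) ≡ k ℤ.* (a ℤ.* m)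
  swap = solve-∀

multiple≡0mod : ∀ m x → + m ℤ.* x ≡ + 0 [mod m ]
multiple≡0mod m x = ≡0mod (divides x (ℤ.*-comm (+ m) x))

-- The distance of `a` and `b` is at most their maximum, hence below `m`, and the only multiple of
-- `m` below `m` is 0.
+-injective-mod : ∀ {m a b} → a < m → b < m → + a ≡ + b [mod m ] → a ≡ b
+-injective-mod {m} {a} {b} a<m b<m eq = ℤ.+-injective (ℤ.i-j≡0⇒i≡j (+ a) (+ b) (ℤ.∣i∣≡0⇒i≡0 small))
  where
  bound : ℤ.∣ + a ℤ.- + b ∣ < m
  bound = ℕ.≤-<-trans (≡.subst (λ x → ℤ.∣ x ∣ ≤ a ℕ.⊔ b) (≡.sym (ℤ.m-n≡m⊖n a b)) (ℤ.∣m⊝n∣≤m⊔n a b))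
                      (ℕ.⊔-lub a<m b<m)
  small : ℤ.∣ + a ℤ.- + b ∣ ≡ 0
  small with ℤ.∣ + a ℤ.- + b ∣ | bound | ≡mod⇒∣ eq
  ... | zero  | _   | _ = ≡.refl
  ... | suc k | k<m | d = contradiction d (ℕ∣.>⇒∤ k<m)

≡0mod⇒∣ : ∀ {m k} → + k ≡ + 0 [mod m ] → m ℕ∣.∣ k
≡0mod⇒∣ {m} {k} eq = ≡.subst (λ x → m ℕ∣.∣ ℤ.∣ x ∣) (ℤ.+-identityʳ (+ k)) (≡mod⇒∣ eq)

ℤmod-^ : ∀ {m} x k → GroupOps._^_ (AbelianGroup.rawGroup (ℤmod m)) x k ≡ + k ℤ.* x
ℤmod-^ x zero = ≡.sym (ℤ.*-zeroˡ x)
ℤmod-^ x (suc k) = ≡.trans (≡.cong (λ y → x ℤ.+ y) (ℤmod-^ x k)) (≡.sym (ℤ.suc-* (+ k) x))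

-- Integer vectors with one modulus per coordinate, and their unit vectors

δ : ∀ {n} → Fin n → Fin n → ℤ
δ fzero    fzero    = + 1
δ fzero    (fsuc j) = + 0
δ (fsuc i) fzero    = + 0
δ (fsuc i) (fsuc j) = δ i j

module _ {n : ℕ} (μ : Fin n → ℕ) where

  Residues : AbelianGroup 0ℓ 0ℓ
  Residues = ΠAbelian (λ i → ℤmod (μ i))

  open AbelianGroup Residues
  open GroupOps rawGroup

  projection-homo : ∀ i → IsGroupHomomorphism rawGroup (AbelianGroup.rawGroup (ℤmod (μ i))) (λ a → a i)
  projection-homo i = mkGroupHom {G = group} {H = AbelianGroup.group (ℤmod (μ i))}
    (λ a → a i) (λ eq → eq i) (λ _ _ → ≡⇒≡mod ≡.refl)

  δ-sum : ∀ {m n} (k : Fin n → ℤ) i →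
    GroupOps.∏ (AbelianGroup.rawGroup (ℤmod m)) (λ j → k j ℤ.* δ j i) ≡ k i [mod m ]
  δ-sum {m} {suc n} k fzero = ≡mod-trans
    (+-cong-mod (≡⇒≡mod (ℤ.*-identityʳ (k fzero)))
                (GroupLemmas.∏-ε (AbelianGroup.group (ℤmod m)) {n} (λ j → ≡⇒≡mod (ℤ.*-zeroʳ (k (fsuc j))))))
    (≡⇒≡mod (ℤ.+-identityʳ (k fzero)))
  δ-sum {m} {suc n} k (fsuc i) = ≡mod-trans
    (+-cong-mod (≡⇒≡mod (ℤ.*-zeroʳ (k fzero))) (δ-sum (k ∘ fsuc) i))
    (≡⇒≡mod (ℤ.+-identityˡ (k (fsuc i))))

  ∏-basis : ∀ {f : Fin n → Carrier} (k : Fin n → ℤ) →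
    (∀ j i → f j i ≡ k j ℤ.* δ j i [mod μ i ]) → ∏ f ≈ k
  ∏-basis {f} k eq i = ≡mod-trans
    (∏-homo {G = group} {H = AbelianGroup.group (ℤmod (μ i))} (projection-homo i) f)
    (≡mod-trans (GroupLemmas.∏-cong (AbelianGroup.group (ℤmod (μ i))) (λ j → eq j i)) (δ-sum k i))

  ^-coordinate : ∀ a k i → (a ^ k) i ≡ + k ℤ.* a i [mod μ i ]
  ^-coordinate a k i = ≡mod-trans
    (^-homo {G = group} {H = AbelianGroup.group (ℤmod (μ i))} (projection-homo i) a k)
    (≡⇒≡mod (ℤmod-^ {μ i} (a i) k))

  ∏-δ^ : ∀ (a : Fin n → ℕ) → ∏ (λ i → δ i ^ a i) ≈ (λ i → + a i)
  ∏-δ^ a = ∏-basis (λ i → + a i) (λ j → ^-coordinate (δ j) (a j))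

  private
    δ-multiple : ∀ z j → (λ i → z ℤ.* δ j i) ∈ ⟨_⟩ group (λ w → ∃[ i ] w ≈ δ i)
    δ-multiple (+ k) j =
      resp (^-coordinate (δ j) k) (power k)
      where
      power : ∀ k → δ j ^ k ∈ ⟨_⟩ group (λ w → ∃[ i ] w ≈ δ i)
      power zero = ε∈
      power (suc k) = ∙∈ (gen (j , λ _ → ≡⇒≡mod ≡.refl)) (power k)
    δ-multiple -[1+ k ] j =
      resp (λ i → ≡⇒≡mod (ℤ.neg-distribˡ-* (+ suc k) (δ j i))) (⁻¹∈ (δ-multiple (+ suc k) j))

    ∏∈ : ∀ {n} {f : Fin n → Carrier} → (∀ j → f j ∈ ⟨_⟩ group (λ w → ∃[ i ] w ≈ δ i)) →
         ∏ f ∈ ⟨_⟩ group (λ w → ∃[ i ] w ≈ δ i)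
    ∏∈ {zero}  f∈ = ε∈
    ∏∈ {suc n} f∈ = ∙∈ (f∈ fzero) (∏∈ (f∈ ∘ fsuc))

  δ-generating : ∀ v → v ∈ ⟨_⟩ group (λ w → ∃[ i ] w ≈ δ i)
  δ-generating v = resp (∏-basis {λ j i → v j ℤ.* δ j i} v (λ _ _ → ≡⇒≡mod ≡.refl))
    (∏∈ (λ j → δ-multiple (v j) j))

δ-inject₁-last : ∀ {n} (k : Fin n) → δ (inject₁ k) (fromℕ n) ≡ + 0
δ-inject₁-last fzero    = ≡.refl
δ-inject₁-last (fsuc k) = δ-inject₁-last k

δ-last-inject₁ : ∀ {n} (k : Fin n) → δ (fromℕ n) (inject₁ k) ≡ + 0
δ-last-inject₁ fzero    = ≡.refl
δ-last-inject₁ (fsuc k) = δ-last-inject₁ k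

δ-last-last : ∀ n → δ (fromℕ n) (fromℕ n) ≡ + 1
δ-last-last zero    = ≡.refl
δ-last-last (suc n) = δ-last-last n

δ-inject₁-inject₁ : ∀ {n} (k j : Fin n) → δ (inject₁ k) (inject₁ j) ≡ δ k j
δ-inject₁-inject₁ fzero    fzero    = ≡.refl
δ-inject₁-inject₁ fzero    (fsuc j) = ≡.refl
δ-inject₁-inject₁ (fsuc k) fzero    = ≡.refl
δ-inject₁-inject₁ (fsuc k) (fsuc j) = δ-inject₁-inject₁ k j

-- The exponent of p in the order of s_(k+1).
exponent : (e r k : ℕ) → ℕ
exponent e zero    k       = e ∸ 1
exponent e (suc r) zero    = e
exponent e (suc r) (suc k) = exponent e r k

exponent-low : ∀ {e r k} → k < r → exponent e r k ≡ e
exponent-low {r = suc r} {zero}  _         = ≡.refl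
exponent-low {r = suc r} {suc k} (s≤s k<r) = exponent-low k<r

exponent-high : ∀ {e r k} → r ≤ k → exponent e r k ≡ e ∸ 1
exponent-high {r = zero}          _         = ≡.refl
exponent-high {r = suc r} {suc k} (s≤s r≤k) = exponent-high r≤k

exponent-≤ : ∀ e r k → exponent e r k ≤ e
exponent-≤ e zero    k       = ℕ.m∸n≤m e 1
exponent-≤ e (suc r) zero    = ℕ.≤-refl
exponent-≤ e (suc r) (suc k) = exponent-≤ e r k

exponent-≥ : ∀ e r k → e ∸ 1 ≤ exponent e r k
exponent-≥ e zero    k       = ℕ.≤-refl
exponent-≥ e (suc r) zero    = ℕ.m∸n≤m e 1
exponent-≥ e (suc r) (suc k) = exponent-≥ e r k

-- The moduli decrease along the basis, so moving a coordinate one place further respects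
-- congruence.
exponent-suc : ∀ e r k → exponent e r (suc k) ≤ exponent e r k
exponent-suc e zero    k       = ℕ.≤-refl
exponent-suc e (suc r) zero    = exponent-≤ e r 0
exponent-suc e (suc r) (suc k) = exponent-suc e r k

^-monoʳ-∣ : ∀ p {m n} → m ≤ n → p ℕ.^ m ℕ∣.∣ p ℕ.^ n
^-monoʳ-∣ p {m} {n} m≤n = ℕ∣.divides (p ℕ.^ (n ∸ m)) (≡.trans
  (≡.cong (p ℕ.^_) (≡.sym (ℕ.m∸n+n≡m m≤n))) (ℕ.^-distribˡ-+-* p (n ∸ m) m))

-- The module ℤ[ζ]/J in the basis of powers of ζ - 1

module CyclotomicModule (n e r : ℕ) (pp : Prime (2+ n)) (1≤e : 1 ≤ e) where

  private
    p = 2+ n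

  μ : Fin (suc n) → ℕ
  μ i = p ℕ.^ exponent e r (toℕ i)

  A : AbelianGroup 0ℓ 0ℓ
  A = Residues μ

  private
    module A where
      open AbelianGroup A public
      open GroupOps rawGroup public

  shift : ∀ {n} → (Fin (suc n) → ℤ) → Fin (suc n) → ℤ
  shift a fzero    = + 0
  shift a (fsuc i) = a (inject₁ i)

  -- The companion matrix of ((1 + X)ᵖ - 1) / X: basis vectors move up by one, and the top power
  -- X^(p-2) is sent to the combination of all basis vectors with coefficients -C(p, i + 1).
  X : A.Carrier → A.Carrier
  X a i = shift a i ℤ.- + (p C suc (toℕ i)) ℤ.* a (fromℕ n)

  shift-cong : ∀ {a b} → a A.≈ b → shift a A.≈ shift b
  shift-cong eq fzero    = ≡⇒≡mod ≡.refl
  shift-cong eq (fsuc i) = ≡mod-weaken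
    (^-monoʳ-∣ p (≡.subst (λ k → exponent e r (suc (toℕ i)) ≤ exponent e r k)
                          (≡.sym (Fin.toℕ-inject₁ i)) (exponent-suc e r (toℕ i))))
    (eq (inject₁ i))

  shift-homo : ∀ (a b : A.Carrier) i → shift (a A.∙ b) i ≡ shift a i ℤ.+ shift b i
  shift-homo a b fzero    = ≡.refl
  shift-homo a b (fsuc i) = ≡.refl

  -- p^e divides p · p^(e-1), and p divides the binomial coefficient.
  X-cong : ∀ {a b} → a A.≈ b → X a A.≈ X b
  X-cong eq i = +-cong-mod (shift-cong eq i) (-‿cong-mod (*-cong-mod {a = p C suc (toℕ i)}
    (ℕ∣.∣-trans (^-monoʳ-∣ p {n = suc (exponent e r (toℕ (fromℕ n)))} (begin
        exponent e r (toℕ i)                    ≤⟨ exponent-≤ e r (toℕ i) ⟩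
        e                                       ≡⟨ ℕ.m+[n∸m]≡n 1≤e ⟨
        suc (e ∸ 1)                             ≤⟨ s≤s (exponent-≥ e r (toℕ (fromℕ n))) ⟩
        suc (exponent e r (toℕ (fromℕ n)))      ∎))
      (ℕ∣.*-monoˡ-∣ (μ (fromℕ n)) (prime∣binomial pp (Fin.toℕ<n i))))
    (eq (fromℕ n))))
    where open ℕ.≤-Reasoning

  X-homo : IsGroupHomomorphism A.rawGroup A.rawGroup X
  X-homo = mkGroupHom {G = A.group} {H = A.group} X X-cong (λ a b i → ≡⇒≡mod (≡.trans
    (≡.cong (ℤ._- + (p C suc (toℕ i)) ℤ.* (a (fromℕ n) ℤ.+ b (fromℕ n))) (shift-homo a b i))
    (linear (shift a i) (shift b i) (+ (p C suc (toℕ i))) (a (fromℕ n)) (b (fromℕ n)))))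
    where
    linear : ∀ x y k u v → (x ℤ.+ y) ℤ.- k ℤ.* (u ℤ.+ v) ≡ (x ℤ.- k ℤ.* u) ℤ.+ (y ℤ.- k ℤ.* v)
    linear = solve-∀

  X-δ-next : ∀ k → X (δ (inject₁ k)) A.≈ δ (fsuc k)
  X-δ-next k i = ≡⇒≡mod (≡.trans
    (≡.cong₂ (λ x y → x ℤ.- + (p C suc (toℕ i)) ℤ.* y) (shifted i) (δ-inject₁-last k))
    (drop (δ (fsuc k) i) (+ (p C suc (toℕ i)))))
    where
    shifted : ∀ i → shift (δ (inject₁ k)) i ≡ δ (fsuc k) i
    shifted fzero    = ≡.refl
    shifted (fsuc j) = δ-inject₁-inject₁ k j
    drop : ∀ x k → x ℤ.- k ℤ.* + 0 ≡ x
    drop = solve-∀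

  X-δ-last : X (δ (fromℕ n)) A.≈ A.∏ (λ j → (δ j A.^ (p C suc (toℕ j))) A.⁻¹)
  X-δ-last = A.trans
    (λ i → ≡⇒≡mod (≡.trans
      (≡.cong₂ (λ x y → x ℤ.- + (p C suc (toℕ i)) ℤ.* y) (shifted i) (δ-last-last n))
      (simplify (+ (p C suc (toℕ i))))))
    (A.sym (∏-basis μ {λ j → (δ j A.^ (p C suc (toℕ j))) A.⁻¹} (λ i → ℤ.- + (p C suc (toℕ i)))
      (λ j i → ≡mod-trans (-‿cong-mod (^-coordinate μ (δ j) (p C suc (toℕ j)) i))
        (≡⇒≡mod (ℤ.neg-distribˡ-* (+ (p C suc (toℕ j))) (δ j i))))))
    where
    shifted : ∀ {n} i → shift (δ (fromℕ n)) i ≡ + 0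
    shifted fzero    = ≡.refl
    shifted (fsuc j) = δ-last-inject₁ j
    simplify : ∀ k → + 0 ℤ.- k ℤ.* + 1 ≡ ℤ.- k
    simplify = solve-∀

δ-multiple≡0 : ∀ {n} (μ : Fin n → ℕ) i j → + μ i ℤ.* δ i j ≡ + 0 [mod μ j ]
δ-multiple≡0 μ fzero    fzero    = multiple≡0mod (μ fzero) (+ 1)
δ-multiple≡0 μ fzero    (fsuc j) = ≡⇒≡mod (ℤ.*-zeroʳ (+ μ fzero))
δ-multiple≡0 μ (fsuc i) fzero    = ≡⇒≡mod (ℤ.*-zeroʳ (+ μ (fsuc i)))
δ-multiple≡0 μ (fsuc i) (fsuc j) = δ-multiple≡0 (μ ∘ fsuc) i j

-- Mixed-radix digits, for counting exponent vectors

product : ∀ {n} → (Fin n → ℕ) → ℕ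
product = foldr ℕ._*_ 1

digits : ∀ {n} (μ : Fin n → ℕ) → Fin (product μ) → ∀ i → Fin (μ i)
digits {suc n} μ k fzero    = proj₁ (remQuot (product (μ ∘ fsuc)) k)
digits {suc n} μ k (fsuc i) = digits (μ ∘ fsuc) (proj₂ (remQuot {μ fzero} _ k)) i

remQuot-injective : ∀ {m} k (i j : Fin (m ℕ.* k)) → remQuot {m} k i ≡ remQuot k j → i ≡ j
remQuot-injective {m} k i j eq = ≡.trans (≡.sym (Fin.combine-remQuot {m} k i))
  (≡.trans (≡.cong (λ (a , b) → combine a b) eq) (Fin.combine-remQuot {m} k j))

digits-injective : ∀ {n} (μ : Fin n → ℕ) {k l} → (∀ i → digits μ k i ≡ digits μ l i) → k ≡ l
digits-injective {zero}  μ {fzero} {fzero} eq = ≡.refl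
digits-injective {suc n} μ {k} {l} eq = remQuot-injective {μ fzero} _ k l
  (≡.cong₂ _,_ (eq fzero) (digits-injective (μ ∘ fsuc) (eq ∘ fsuc)))

digits-surjective : ∀ {n} (μ : Fin n → ℕ) (a : ∀ i → Fin (μ i)) → ∃[ k ] (∀ i → digits μ k i ≡ a i)
digits-surjective {zero}  μ a = fzero , λ ()
digits-surjective {suc n} μ a with digits-surjective (μ ∘ fsuc) (a ∘ fsuc)
... | k , eq = combine (a fzero) k , λ where
    fzero    → ≡.cong proj₁ split
    (fsuc i) → ≡.trans (≡.cong (λ x → digits (μ ∘ fsuc) (proj₂ x) i) split) (eq i)
  where split = Fin.remQuot-combine (a fzero) k

-- The factors are r copies of p^e followed by n - r copies of p^(e-1).
product-^-exponent : ∀ p e r n → r ≤ n →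
  product {n} (λ i → p ℕ.^ exponent e r (toℕ i)) ≡ p ℕ.^ (e ℕ.* r ℕ.+ (e ∸ 1) ℕ.* (n ∸ r))
product-^-exponent p e zero zero z≤n =
  ≡.sym (≡.cong₂ (λ x y → p ℕ.^ (x ℕ.+ y)) (ℕ.*-zeroʳ e) (ℕ.*-zeroʳ (e ∸ 1)))
product-^-exponent p e zero (suc n) z≤n =
  ≡.trans (≡.cong (p ℕ.^ (e ∸ 1) ℕ.*_) (product-^-exponent p e zero n z≤n))
    (≡.trans (≡.sym (ℕ.^-distribˡ-+-* p (e ∸ 1) _)) (≡.cong (p ℕ.^_) (lem e (e ∸ 1) n)))
  where
  lem : ∀ e f n → f ℕ.+ (e ℕ.* 0 ℕ.+ f ℕ.* n) ≡ e ℕ.* 0 ℕ.+ f ℕ.* suc n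
  lem = ℕ-RingSolver.solve-∀
product-^-exponent p e (suc r) (suc n) (s≤s r≤n) =
  ≡.trans (≡.cong (p ℕ.^ e ℕ.*_) (product-^-exponent p e r n r≤n))
    (≡.trans (≡.sym (ℕ.^-distribˡ-+-* p e _)) (≡.cong (p ℕ.^_) (lem e r _)))
  where
  lem : ∀ e r x → e ℕ.+ (e ℕ.* r ℕ.+ x) ≡ e ℕ.* suc r ℕ.+ x
  lem = ℕ-RingSolver.solve-∀

-- Turns the numerical indices of the relators into the pair `inject₁ k`, `fsuc k` along which X
-- moves the basis.
toℕ≡suc : ∀ {n} (i : Fin (suc n)) (j : Fin (suc n)) → toℕ j ≡ suc (toℕ i) →
          ∃[ k ] i ≡ inject₁ k × j ≡ fsuc k
toℕ≡suc i (fsuc k) eq =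
  k , Fin.toℕ-injective (≡.trans (≡.sym (ℕ.suc-injective eq)) (≡.sym (Fin.toℕ-inject₁ k))) , ≡.refl

-- The representation of G in the holomorph of A

module Holomorph {c ℓ} (M : AbelianGroup c ℓ) where
  private
    module M where
      open AbelianGroup M public
      open GroupOps rawGroup public

  Hol : Group _ _
  Hol = SemidirectProduct M.group (Aut M.group) id
          (Identity.isGroupHomomorphism (Group.rawGroup (Aut M.group))
            (λ {f} → Group.refl (Aut M.group) {f}))

  private module Hol = Group Hol

  embed : M.Carrier → Hol.Carrier
  embed a = a , Group.ε (Aut M.group)

  embed-homo : IsGroupHomomorphism M.rawGroup Hol.rawGroup embed
  embed-homo = mkGroupHom {G = M.group} {H = Hol} embed
    (λ eq → eq , λ _ → M.refl) (λ a b → M.refl , λ _ → M.refl)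

module ExtensionByUnipotent {c ℓ c′ ℓ′} (M : AbelianGroup c ℓ) (X : AbelianGroup.Carrier M → AbelianGroup.Carrier M)
  (n : ℕ) (d : Fin (suc n) → AbelianGroup.Carrier M)
  (X-next : ∀ k → AbelianGroup._≈_ M (X (d (inject₁ k))) (d (fsuc k)))
  (X-last : AbelianGroup._≈_ M (X (d (fromℕ n)))
    (GroupOps.∏ (AbelianGroup.rawGroup M)
      (λ j → AbelianGroup._⁻¹ M (GroupOps._^_ (AbelianGroup.rawGroup M) (d j) (2+ n C suc (toℕ j))))))
  (e r : ℕ)
  (d-order : ∀ i → AbelianGroup._≈_ M
    (GroupOps._^_ (AbelianGroup.rawGroup M) (d i) (2+ n ℕ.^ exponent e r (toℕ i)))
    (AbelianGroup.ε M))
  (H : Group c′ ℓ′) (embed : AbelianGroup.Carrier M → Group.Carrier H)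
  (embed-homo : IsGroupHomomorphism (AbelianGroup.rawGroup M) (Group.rawGroup H) embed)
  (t : Group.Carrier H)
  (t-conjugates : ∀ a → Group._≈_ H (Group._∙_ H t (embed a))
    (Group._∙_ H (Group._∙_ H (embed a) (embed (X a))) t))
  (t^p≈ε : Group._≈_ H (GroupOps._^_ (Group.rawGroup H) t (2+ n)) (Group.ε H))
  where

  private
    p = 2+ n
    module M where
      open AbelianGroup M public
      open GroupOps rawGroup public
    module H where
      open Group H public
      open GroupOps rawGroup public
      open GroupLemmas H public
      open GroupProperties H public
    module W where
      open GroupOps (wordRawGroup (Generator p)) public
    module embed = IsGroupHomomorphism embed-homo

  -- The relation [s_k, β] = s_(k+1) asks for β⁻¹aβ = a · X a, whereas `t-conjugates` gives tat⁻¹ =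
  -- a · X a. So β has to go to the inverse of `t`.
  image : Generator p → H.Carrier
  image (s i) = embed (d i)
  image β     = t H.⁻¹

  open Lift (Relator p e r) H image

  lift-s^ : ∀ i k → lift (η (s i) W.^ k) H.≈ embed (d i M.^ k)
  lift-s^ i k = H.trans (H.reflexive (lift-^ (η (s i)) k))
    (H.sym (^-homo {G = M.group} {H = H} embed-homo (d i) k))

  [embed,t⁻¹] : ∀ a → H.[ embed a , t H.⁻¹ ] H.≈ embed (X a)
  [embed,t⁻¹] a = H.commutator⁻¹-unique (t-conjugates a)

  respects : ∀ {x y} → Relator p e r x y → lift x H.≈ lift y
  respects (s-power-low i i<r) = H.trans (lift-s^ i (p ℕ.^ e)) (H.trans
    (embed.⟦⟧-cong (≡.subst (λ k → d i M.^ (p ℕ.^ k) M.≈ M.ε) (exponent-low i<r) (d-order i)))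
    embed.ε-homo)
  respects (s-power-high i r≤i) = H.trans (lift-s^ i (p ℕ.^ (e ∸ 1))) (H.trans
    (embed.⟦⟧-cong (≡.subst (λ k → d i M.^ (p ℕ.^ k) M.≈ M.ε) (exponent-high r≤i) (d-order i)))
    embed.ε-homo)
  respects β-power = H.trans (H.reflexive (lift-^ (η β) p))
    (H.trans (H.⁻¹-^ t p) (H.trans (H.⁻¹-cong t^p≈ε) H.ε⁻¹≈ε))
  respects (s-commute i j) = H.commuting⇒commutator≈ε
    (H.trans (H.sym (embed.homo _ _)) (H.trans (embed.⟦⟧-cong (M.comm _ _)) (embed.homo _ _)))
  respects (s-next i j eq) with k , ≡.refl , ≡.refl ← toℕ≡suc i j eq =
    H.sym (H.trans ([embed,t⁻¹] (d i)) (embed.⟦⟧-cong (X-next k)))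
  respects (s-last i eq) with ≡.refl ← Fin.toℕ-injective {i = i} {j = fromℕ n}
                                (≡.trans (ℕ.suc-injective eq) (≡.sym (Fin.toℕ-fromℕ n))) = begin
    H.[ embed (d i) , t H.⁻¹ ]
      ≈⟨ [embed,t⁻¹] (d i) ⟩
    embed (X (d i))
      ≈⟨ embed.⟦⟧-cong X-last ⟩
    embed (M.∏ (λ j → (d j M.^ (p C suc (toℕ j))) M.⁻¹))
      ≈⟨ ∏-homo {G = M.group} {H = H} embed-homo (λ j → (d j M.^ (p C suc (toℕ j))) M.⁻¹) ⟩
    H.∏ (λ j → embed ((d j M.^ (p C suc (toℕ j))) M.⁻¹))
      ≈⟨ H.∏-cong {suc n} (λ j → H.trans (embed.⁻¹-homo _)
           (H.⁻¹-cong (H.sym (lift-s^ j (p C suc (toℕ j)))))) ⟩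
    H.∏ (λ j → lift ((η (s j) W.^ (p C suc (toℕ j))) ⁻¹))
      ≡⟨ lift-∏ (λ j → (η (s j) W.^ (p C suc (toℕ j))) ⁻¹) ⟨
    lift (W.∏ (λ j → (η (s j) W.^ (p C suc (toℕ j))) ⁻¹)) ∎
    where open SetoidReasoning H.setoid

  lift-∏-s^ : ∀ (a : Fin (suc n) → ℕ) → lift (W.∏ (λ i → η (s i) W.^ a i)) H.≈ embed (M.∏ (λ i → d i M.^ a i))
  lift-∏-s^ a = H.trans (H.reflexive (lift-∏ (λ i → η (s i) W.^ a i)))
    (H.trans (H.∏-cong {suc n} (λ i → lift-s^ i (a i)))
      (H.sym (∏-homo {G = M.group} {H = H} embed-homo {suc n} (λ i → d i M.^ a i))))

module Representation {c ℓ} (M : AbelianGroup c ℓ) (X : AbelianGroup.Carrier M → AbelianGroup.Carrier M)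
  (X-hom : IsGroupHomomorphism (AbelianGroup.rawGroup M) (AbelianGroup.rawGroup M) X)
  (n : ℕ) (d : Fin (suc n) → AbelianGroup.Carrier M)
  (X-next : ∀ k → AbelianGroup._≈_ M (X (d (inject₁ k))) (d (fsuc k)))
  (X-last : AbelianGroup._≈_ M (X (d (fromℕ n)))
    (GroupOps.∏ (AbelianGroup.rawGroup M)
      (λ j → AbelianGroup._⁻¹ M (GroupOps._^_ (AbelianGroup.rawGroup M) (d j) (2+ n C suc (toℕ j))))))
  (generating : ∀ v → v ∈ ⟨_⟩ (AbelianGroup.group M) (λ w → ∃[ i ] AbelianGroup._≈_ M w (d i)))
  (e r : ℕ)
  (d-order : ∀ i → AbelianGroup._≈_ M
    (GroupOps._^_ (AbelianGroup.rawGroup M) (d i) (2+ n ℕ.^ exponent e r (toℕ i)))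
    (AbelianGroup.ε M))
  where

  open UnipotentOperator M X X-hom using (T; T-cong; T^; geometric; module Cyclotomic)
  open Cyclotomic n d X-next X-last generating
  open Holomorph M
  private
    p = 2+ n
    module M where
      open AbelianGroup M public
      open GroupOps rawGroup public
    module Hol where
      open Group Hol public
      open GroupOps rawGroup public
    module W where
      open GroupOps (wordRawGroup (Generator p)) public

  open Automorphism using (⟦_⟧)

  t : Hol.Carrier
  t = M.ε , T-automorphism

  module _ {x : Hol.Carrier} (x-acts : ∀ v → ⟦ proj₂ x ⟧ v M.≈ T v) where

    ^-translation : ∀ k → proj₁ (x Hol.^ k) M.≈ geometric k (proj₁ x)
    ^-translation zero    = M.refl
    ^-translation (suc k) = M.∙-congˡ (M.trans (x-acts _) (T-cong (^-translation k)))

    ^-action : ∀ k v → ⟦ proj₂ (x Hol.^ k) ⟧ v M.≈ T^ k v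
    ^-action zero    v = M.refl
    ^-action (suc k) v = M.trans (x-acts _) (T-cong (^-action k v))

    -- The k-th power of (v, T) is ((1 + T + ⋯ + T^(k-1)) v, Tᵏ), and for k = p both components are
    -- trivial whatever v is. The same computation serves for `t`, where v is trivial, and for
    -- s₁β⁻¹.
    ^p≈ε : x Hol.^ p Hol.≈ Hol.ε
    ^p≈ε = M.trans (^-translation p) (geometric≈ε _) , λ v → M.trans (^-action p v) (T^≈id v)

  t-conjugates : ∀ a → t Hol.∙ embed a Hol.≈ embed a Hol.∙ embed (X a) Hol.∙ t
  t-conjugates a = M.trans (M.identityˡ _) (M.sym (M.identityʳ _)) , λ _ → M.refl

  open ExtensionByUnipotent M X n d X-next X-last e r d-order Hol embed embed-homo t t-conjugates (^p≈ε λ _ → M.refl)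
  open Lift (Relator p e r) Hol image

  rep : Word (Generator p) → Hol.Carrier
  rep = lift

  rep-cong : ∀ {x y} → Group._≈_ (G p e r) x y → rep x Hol.≈ rep y
  rep-cong = lift-cong (λ {x} {y} → respects {x} {y})

  rep-∏ : (a : Fin (suc n) → ℕ) →
    rep (W.∏ (λ i → η (s i) W.^ a i)) Hol.≈ embed (M.∏ (λ i → d i M.^ a i))
  rep-∏ = lift-∏-s^

  rep-^p≈ε : ∀ w → (∀ v → ⟦ proj₂ (rep w) ⟧ v M.≈ T v) → rep (w W.^ p) Hol.≈ Hol.ε
  rep-^p≈ε w w-acts = ≡.subst (Hol._≈ Hol.ε) (≡.sym (lift-^ w p)) (^p≈ε {x = rep w} w-acts)

  rep-[s₁β⁻¹]^p : rep ((η (s fzero) ∙ η β ⁻¹) W.^ p) Hol.≈ Hol.ε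
  -- β⁻¹ goes to the double inverse of `t`, and inverting `T-automorphism` twice gives back the
  -- function T by computation.
  rep-[s₁β⁻¹]^p = rep-^p≈ε (η (s fzero) ∙ η β ⁻¹) (λ _ → M.refl)

-- Orders and normal forms in G

module Characters (n e r : ℕ) (pp : Prime (2+ n)) (1≤e : 1 ≤ e) (1≤r : 1 ≤ r) where
  private
    p = 2+ n
    module Z where
      open AbelianGroup (ℤmod p) public
      open GroupOps rawGroup public
      open GroupLemmas group public

  module _ (x y : ℤ) where

    -- The later generators are commutators, so every character to ℤ/p kills them. The values at s₁
    -- and β are free: s₁ and β occur to powers divisible by p, and in the last relator s₁ has the
    -- exponent C(p,1) = p.
    value : Generator p → ℤ
    value (s fzero)    = x
    value (s (fsuc _)) = + 0
    value β            = y

    open Lift (Relator p e r) Z.group value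

    private
      multiple^≈0 : ∀ z {k} → p ℕ∣.∣ k → z Z.^ k Z.≈ + 0
      multiple^≈0 z (ℕ∣.divides q ≡.refl) = ≡mod-trans
        (≡⇒≡mod (≡.trans (ℤmod-^ {p} z (q ℕ.* p))
          (≡.trans (≡.cong (λ k → + k ℤ.* z) (ℕ.*-comm q p))
            (≡.trans (≡.cong (ℤ._* z) (ℤ.pos-* p q)) (ℤ.*-assoc (+ p) (+ q) z)))))
        (multiple≡0mod p _)

      0^≈0 : ∀ k → (+ 0) Z.^ k Z.≈ + 0
      0^≈0 = Z.ε^n≈ε

      commutator≈0 : ∀ u v → Z.[ u , v ] Z.≈ + 0
      commutator≈0 u v = Z.commuting⇒commutator≈ε {u} {v} (Z.comm u v)

    respects : ∀ {u v} → Relator p e r u v → lift u Z.≈ lift v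
    respects (s-power-low i i<r) = Z.trans (Z.reflexive (lift-^ (η (s i)) (p ℕ.^ e)))
      (multiple^≈0 _ (≡.subst (λ k → p ℕ∣.∣ p ℕ.^ k) (ℕ.m+[n∸m]≡n 1≤e) (ℕ∣.m∣m*n (p ℕ.^ (e ∸ 1)))))
    -- For e = 1 this relator would force x to vanish; 1 ≤ r keeps s₁ among the generators of order
    -- p^e.
    respects (s-power-high fzero r≤i) = contradiction (ℕ.≤-trans 1≤r r≤i) λ ()
    respects (s-power-high (fsuc i) r≤i) =
      Z.trans (Z.reflexive (lift-^ (η (s (fsuc i))) (p ℕ.^ (e ∸ 1)))) (0^≈0 (p ℕ.^ (e ∸ 1)))
    respects β-power = Z.trans (Z.reflexive (lift-^ (η β) p)) (multiple^≈0 y ℕ∣.∣-refl)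
    respects (s-commute i j) = commutator≈0 (value (s i)) (value (s j))
    respects (s-next i (fsuc j) eq) = Z.sym (commutator≈0 (value (s i)) y)
    respects (s-last i eq) = Z.trans (commutator≈0 (value (s i)) y) (Z.sym (Z.trans
      (Z.reflexive (lift-∏ (λ j → GroupOps._^_ (wordRawGroup (Generator p)) (η (s j)) (p C suc (toℕ j)) ⁻¹)))
      (Z.∏-ε {suc n} λ j → Z.⁻¹-cong {y = + 0} (Z.trans (Z.reflexive (lift-^ (η (s j)) (p C suc (toℕ j)))) (power j)))))
      where
      power : ∀ j → value (s j) Z.^ (p C suc (toℕ j)) Z.≈ + 0
      power fzero    = multiple^≈0 x (ℕ∣.∣-reflexive (≡.sym (nC1≡n p)))
      power (fsuc j) = 0^≈0 (p C suc (suc (toℕ j)))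

    χ : Word (Generator p) → ℤ
    χ = lift

    χ-homo : IsGroupHomomorphism (Group.rawGroup (G p e r)) Z.rawGroup χ
    χ-homo = lift-isGroupHomomorphism (λ {u} {v} → respects {u} {v})

module NormalForm (n e r : ℕ) (pp : Prime (2+ n)) (1≤e : 1 ≤ e) (1≤r : 1 ≤ r) where

  private
    p = 2+ n
    module W where
      open Group (G p e r) public
      open GroupOps rawGroup public
      open GroupLemmas (G p e r) public
      open GroupProperties (G p e r) public
    module Raw = GroupOps (wordRawGroup (Generator p))
  open SetoidReasoning W.setoid

  private
    μ : Fin (suc n) → ℕ
    μ i = p ℕ.^ exponent e r (toℕ i)

    instance
      μ-nonZero : ∀ {i} → NonZero (μ i)
      μ-nonZero {i} = ℕ.m^n≢0 p (exponent e r (toℕ i))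

  -- The relators take powers in the raw group of words with propositional equality.
  word-^ : ∀ x k → x Raw.^ k ≡ x W.^ k
  word-^ x zero    = ≡.refl
  word-^ x (suc k) = ≡.cong (x W.∙_) (word-^ x k)

  word-∏ : ∀ {m} {f g : Fin m → W.Carrier} → (∀ i → f i ≡ g i) → Raw.∏ f ≡ W.∏ g
  word-∏ {zero}  eq = ≡.refl
  word-∏ {suc m} eq = ≡.cong₂ W._∙_ (eq fzero) (word-∏ (eq ∘ fsuc))

  S : Fin (suc n) → W.Carrier
  S i = η (s i)

  B : W.Carrier
  B = η β

  S-comm : ∀ i j → S i W.∙ S j W.≈ S j W.∙ S i
  S-comm i j = W.commutator≈ε⇒commuting (rel (s-commute i j))

  S-order : ∀ i → S i W.^ μ i W.≈ W.ε
  S-order i = W.trans (W.reflexive (≡.sym (word-^ (S i) (μ i)))) (word-order i)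
    where
    word-order : ∀ i → S i Raw.^ μ i W.≈ W.ε
    word-order i with toℕ i ℕ.<? r
    ... | yes i<r = ≡.subst (λ k → S i Raw.^ (p ℕ.^ k) W.≈ W.ε) (≡.sym (exponent-low i<r))
                      (rel (s-power-low i i<r))
    ... | no  i≮r = ≡.subst (λ k → S i Raw.^ (p ℕ.^ k) W.≈ W.ε) (≡.sym (exponent-high (ℕ.≮⇒≥ i≮r)))
                      (rel (s-power-high i (ℕ.≮⇒≥ i≮r)))

  B-order : B W.^ p W.≈ W.ε
  B-order = W.trans (W.reflexive (≡.sym (word-^ B p))) (rel β-power)

  S^ : (Fin (suc n) → ℕ) → W.Carrier
  S^ a = W.∏ (λ i → S i W.^ a i)

  IsNormal : W.Carrier → Set
  IsNormal x = ∃[ j ] ∃[ a ] x W.≈ B W.^ j W.∙ S^ a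

  IsNormal-resp : ∀ {x y} → x W.≈ y → IsNormal x → IsNormal y
  IsNormal-resp x≈y (j , a , eq) = j , a , W.trans (W.sym x≈y) eq

  -- The elements with this property form a submonoid. Once it contains the generators and their
  -- inverses, every word is reached from the normal word ε by right multiplication.
  Stabilizing : W.Carrier → Set
  Stabilizing w = ∀ {x} → IsNormal x → IsNormal (x W.∙ w)

  stabilizing-resp : ∀ {v w} → v W.≈ w → Stabilizing v → Stabilizing w
  stabilizing-resp v≈w sv x = IsNormal-resp (W.∙-congˡ v≈w) (sv x)

  stabilizing-ε : Stabilizing W.ε
  stabilizing-ε = IsNormal-resp (W.sym (W.identityʳ _))

  stabilizing-∙ : ∀ {v w} → Stabilizing v → Stabilizing w → Stabilizing (v W.∙ w)
  stabilizing-∙ sv sw x = IsNormal-resp (W.assoc _ _ _) (sw (sv x))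

  stabilizing-^ : ∀ {w} → Stabilizing w → ∀ k → Stabilizing (w W.^ k)
  stabilizing-^ sw zero    = stabilizing-ε
  stabilizing-^ sw (suc k) = stabilizing-∙ sw (stabilizing-^ sw k)

  stabilizing-∏ : ∀ {m} {f : Fin m → W.Carrier} → (∀ i → Stabilizing (f i)) → Stabilizing (W.∏ f)
  stabilizing-∏ {zero}  sf = stabilizing-ε
  stabilizing-∏ {suc m} sf = stabilizing-∙ (sf fzero) (stabilizing-∏ (sf ∘ fsuc))

  stabilizing-⁻¹ : ∀ {w} N .{{_ : NonZero N}} → w W.^ N W.≈ W.ε → Stabilizing w → Stabilizing (w W.⁻¹)
  stabilizing-⁻¹ N w-order sw =
    stabilizing-resp (W.sym (W.⁻¹≈^ N w-order)) (stabilizing-^ sw (ℕ.pred N))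

  S-stabilizing : ∀ i → Stabilizing (S i)
  S-stabilizing i {x} (j , a , eq) = j , W.increment i a , (begin
    x W.∙ S i                               ≈⟨ W.∙-congʳ eq ⟩
    B W.^ j W.∙ S^ a W.∙ S i                ≈⟨ W.assoc _ _ _ ⟩
    B W.^ j W.∙ (S^ a W.∙ S i)              ≈⟨ W.∙-congˡ (W.∏-^-∙ S-comm a i) ⟩
    B W.^ j W.∙ S^ (W.increment i a)        ∎)

  S⁻¹-stabilizing : ∀ i → Stabilizing (S i W.⁻¹)
  S⁻¹-stabilizing i = stabilizing-⁻¹ (μ i) (S-order i) (S-stabilizing i)

  [S,B]-stabilizing : ∀ i → Stabilizing W.[ S i , B ]
  [S,B]-stabilizing i with suc (toℕ i) ℕ.<? suc n
  ... | yes i<n = stabilizing-resp (rel (s-next i (fromℕ< i<n) (Fin.toℕ-fromℕ< i<n)))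
                    (S-stabilizing (fromℕ< i<n))
  ... | no  i≮n = stabilizing-resp (W.sym (rel (s-last i (ℕ.≤-antisym (Fin.toℕ<n i) (ℕ.≮⇒≥ i≮n)))))
                    (stabilizing-resp (W.reflexive (≡.sym (word-∏ {f = λ j → (S j Raw.^ (p C suc (toℕ j))) W.⁻¹}
                       λ j → ≡.cong W._⁻¹ (word-^ (S j) (p C suc (toℕ j))))))
                    (stabilizing-∏ λ j → stabilizing-resp (W.⁻¹-^ (S j) (p C suc (toℕ j)))
                       (stabilizing-^ (S⁻¹-stabilizing j) (p C suc (toℕ j)))))

  -- Moving β to the left past the powers of the s_i replaces each s_i by s_i[s_i, β]. The result is
  -- not in normal form, but it is obtained from β^(j+1) by right multiplication with factors
  -- already known to be stabilizing.
  B-stabilizing : Stabilizing B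
  B-stabilizing {x} (j , a , eq) = IsNormal-resp (W.sym x∙B)
    (stabilizing-∏ {f = λ i → (S i W.∙ W.[ S i , B ]) W.^ a i}
      (λ i → stabilizing-^ (stabilizing-∙ (S-stabilizing i) ([S,B]-stabilizing i)) (a i))
      (suc j , (λ _ → 0) , W.trans (W.sym (W.identityʳ _))
                             (W.∙-congˡ (W.sym (W.∏-ε {suc n} λ _ → W.refl)))))
    where
    conjugated : W.Carrier
    conjugated = W.∏ λ i → (S i W.∙ W.[ S i , B ]) W.^ a i
    x∙B : x W.∙ B W.≈ B W.^ suc j W.∙ conjugated
    x∙B = begin
      x W.∙ B                              ≈⟨ W.∙-congʳ eq ⟩
      B W.^ j W.∙ S^ a W.∙ B               ≈⟨ W.assoc _ _ _ ⟩
      B W.^ j W.∙ (S^ a W.∙ B)             ≈⟨ W.∙-congˡ (W.∏-intertwine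
                                                 λ i → W.^-intertwine (W.∙-commutator (S i) B) (a i)) ⟩
      B W.^ j W.∙ (B W.∙ conjugated)       ≈⟨ W.assoc _ _ _ ⟨
      B W.^ j W.∙ B W.∙ conjugated         ≈⟨ W.∙-congʳ (W.^-intertwine W.refl j) ⟩
      B W.∙ B W.^ j W.∙ conjugated         ∎

  stabilizing : ∀ w → Stabilizing w × Stabilizing (w W.⁻¹)
  stabilizing (η (s i)) = S-stabilizing i , S⁻¹-stabilizing i
  stabilizing (η β)     = B-stabilizing , stabilizing-⁻¹ p B-order B-stabilizing
  stabilizing ε         = stabilizing-ε , stabilizing-resp (W.sym W.ε⁻¹≈ε) stabilizing-ε
  stabilizing (v ∙ w) with stabilizing v | stabilizing w
  ... | sv , sv⁻¹ | sw , sw⁻¹ =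
    stabilizing-∙ sv sw , stabilizing-resp (W.sym (W.⁻¹-anti-homo-∙ v w)) (stabilizing-∙ sw⁻¹ sv⁻¹)
  stabilizing (w ⁻¹) with stabilizing w
  ... | sw , sw⁻¹ = sw⁻¹ , stabilizing-resp (W.sym (W.⁻¹-involutive w)) sw

  isNormal : ∀ w → IsNormal w
  isNormal w = IsNormal-resp (W.identityˡ w) (proj₁ (stabilizing w)
    (0 , (λ _ → 0) , W.sym (W.trans (W.identityˡ _) (W.∏-ε {suc n} λ _ → W.refl))))

  normalForm : Fin p → (∀ i → Fin (μ i)) → W.Carrier
  normalForm j a = B W.^ toℕ j W.∙ S^ (toℕ ∘ a)

  reduced : ∀ w → ∃[ j ] ∃[ a ] w W.≈ normalForm j a
  reduced w with isNormal w
  ... | j , a , eq = fromℕ< (m%n<n j p) , (λ i → fromℕ< (m%n<n (a i) (μ i))) ,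
    W.trans eq (W.∙-cong (reduce B p B-order j) (W.∏-cong {suc n} λ i → reduce (S i) (μ i) (S-order i) (a i)))
    where
    reduce : ∀ x N .{{_ : NonZero N}} → x W.^ N W.≈ W.ε → ∀ k →
             x W.^ k W.≈ x W.^ toℕ (fromℕ< (m%n<n k N))
    reduce x N x-order k = W.trans (W.^-% N x-order k)
      (W.reflexive (≡.cong (x W.^_) (≡.sym (Fin.toℕ-fromℕ< (m%n<n k N)))))

  open CyclotomicModule n e r pp 1≤e using (A; X; X-homo; X-δ-next; X-δ-last)
  open Characters n e r pp 1≤e 1≤r using (χ; χ-homo)
  private
    module A = AbelianGroup A
    module Rep = Representation A X X-homo n δ X-δ-next X-δ-last (δ-generating μ) e r
      (λ i j → ≡mod-trans (^-coordinate μ (δ i) (μ i) j) (δ-multiple≡0 μ i j))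

  β-exponent : W.Carrier → ℤ
  β-exponent = χ (+ 0) (+ 1)

  β-exponent-cong : ∀ {v w} → v W.≈ w → β-exponent v ≡ β-exponent w [mod p ]
  β-exponent-cong = IsGroupHomomorphism.⟦⟧-cong (χ-homo (+ 0) (+ 1))

  β-exponent-normal : ∀ j a → β-exponent (B W.^ j W.∙ S^ a) ≡ + j [mod p ]
  β-exponent-normal j a = Z.trans (χ.homo (B W.^ j) (S^ a)) (Z.trans (Z.∙-cong
    (Z.trans (^-homo {G = G p e r} {H = Z.group} (χ-homo (+ 0) (+ 1)) B j)
      (≡⇒≡mod (≡.trans (ℤmod-^ {p} (+ 1) j) (ℤ.*-identityʳ (+ j)))))
    (Z.trans (∏-homo {G = G p e r} {H = Z.group} (χ-homo (+ 0) (+ 1)) (λ i → S i W.^ a i))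
      (Z.∏-ε {suc n} λ i → Z.trans (^-homo {G = G p e r} {H = Z.group} (χ-homo (+ 0) (+ 1)) (S i) (a i))
        (s-value i (a i)))))
    (Z.identityʳ (+ j)))
    where
    module Z where
      open AbelianGroup (ℤmod p) public
      open GroupOps rawGroup public
      open GroupLemmas group public
    module χ = IsGroupHomomorphism (χ-homo (+ 0) (+ 1))
    s-value : ∀ i k → β-exponent (S i) Z.^ k Z.≈ + 0
    s-value fzero    = Z.ε^n≈ε
    s-value (fsuc i) = Z.ε^n≈ε

  translation : W.Carrier → Fin (suc n) → ℤ
  translation w = proj₁ (Rep.rep w)

  translation-cong : ∀ {v w} → v W.≈ w → ∀ i → translation v i ≡ translation w i [mod μ i ]
  translation-cong eq = proj₁ (Rep.rep-cong eq)

  S^-translation : ∀ a i → translation (S^ a) i ≡ + a i [mod μ i ]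
  S^-translation a i = A.trans
    (A.trans (A.reflexive (≡.cong translation (≡.sym (word-∏ λ i → word-^ (S i) (a i)))))
      (proj₁ (Rep.rep-∏ a)))
    (∏-δ^ μ a) i

  -- The character recovers j. The translation part is no homomorphism, since β twists it by a power
  -- of T, so the power of β is cancelled before the exponents a are read off.
  normalForm-injective : ∀ {j j′ a a′} → normalForm j a W.≈ normalForm j′ a′ → j ≡ j′ × (∀ i → a i ≡ a′ i)
  normalForm-injective {j} {j′} {a} {a′} eq = j≡j′ , λ i → Fin.toℕ-injective
    (+-injective-mod (Fin.toℕ<n (a i)) (Fin.toℕ<n (a′ i))
      (≡mod-trans (≡mod-sym (S^-translation (toℕ ∘ a) i))
        (≡mod-trans (translation-cong S^-eq i) (S^-translation (toℕ ∘ a′) i))))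
    where
    j≡j′ : j ≡ j′
    j≡j′ = Fin.toℕ-injective (+-injective-mod (Fin.toℕ<n j) (Fin.toℕ<n j′)
      (≡mod-trans (≡mod-sym (β-exponent-normal (toℕ j) (toℕ ∘ a)))
        (≡mod-trans (β-exponent-cong eq) (β-exponent-normal (toℕ j′) (toℕ ∘ a′)))))
    S^-eq : S^ (toℕ ∘ a) W.≈ S^ (toℕ ∘ a′)
    S^-eq = W.∙-cancelˡ (B W.^ toℕ j) _ _
      (W.trans eq (W.∙-congʳ (W.reflexive (≡.cong (λ j → B W.^ toℕ j) (≡.sym j≡j′)))))

  -- The two invariants of the normal form of `w` are its exponents modulo their bounds, so all of
  -- these are 0. This carries identities from the holomorph back to G.
  faithful : ∀ w → β-exponent w ≡ + 0 [mod p ] → (∀ i → translation w i ≡ + 0 [mod μ i ]) → w W.≈ W.ε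
  faithful w wβ wA = W.trans eq (W.trans (W.∙-cong B≈ε (W.∏-ε {suc n} λ i → S≈ε i)) (W.identityʳ W.ε))
    where
    j = proj₁ (reduced w)
    a = proj₁ (proj₂ (reduced w))
    eq : w W.≈ normalForm j a
    eq = proj₂ (proj₂ (reduced w))
    zero-exponent : ∀ x {m} → (k : Fin m) → + toℕ k ≡ + 0 [mod m ] → x W.^ toℕ k W.≈ W.ε
    zero-exponent x {suc m} k eq =
      W.reflexive (≡.cong (x W.^_) (+-injective-mod (Fin.toℕ<n k) ℕ.z<s eq))
    B≈ε : B W.^ toℕ j W.≈ W.ε
    B≈ε = zero-exponent B j (≡mod-trans (≡mod-sym (β-exponent-normal (toℕ j) (toℕ ∘ a)))
            (≡mod-trans (β-exponent-cong (W.sym eq)) wβ))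
    w≈S^ : w W.≈ S^ (toℕ ∘ a)
    w≈S^ = W.trans eq (W.trans (W.∙-congʳ B≈ε) (W.identityˡ _))
    S≈ε : ∀ i → S i W.^ toℕ (a i) W.≈ W.ε
    S≈ε i = zero-exponent (S i) (a i) (≡mod-trans (≡mod-sym (S^-translation (toℕ ∘ a) i))
              (≡mod-trans (translation-cong (W.sym w≈S^) i) (wA i)))

  [s₁β⁻¹]^p≈ε : (S fzero W.∙ B W.⁻¹) W.^ p W.≈ W.ε
  [s₁β⁻¹]^p≈ε = faithful ((S fzero W.∙ B W.⁻¹) W.^ p)
    -- Each of the p factors s₁β⁻¹ contributes -1 to the exponent of β.
    (≡mod-trans (^-homo {G = G p e r} {H = AbelianGroup.group (ℤmod p)} (χ-homo (+ 0) (+ 1)) (S fzero W.∙ B W.⁻¹) p)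
      (≡mod-trans (≡⇒≡mod (ℤmod-^ {p} -[1+ 0 ] p)) (multiple≡0mod p -[1+ 0 ])))
    (A.trans (A.reflexive (≡.cong translation (≡.sym (word-^ (S fzero W.∙ B W.⁻¹) p))))
      (proj₁ Rep.rep-[s₁β⁻¹]^p))

  module _ (r≤n : r ≤ suc n) where

    order : GroupOrder (G p e r) (p ℕ.^ (e ℕ.* r ℕ.+ (e ∸ 1) ℕ.* (p ∸ r ∸ 1) ℕ.+ 1))
    order = ≡.subst (GroupOrder (G p e r)) count record
      { to        = enumerate
      ; cong      = λ { ≡.refl → W.refl }
      ; bijective = (λ eq → let j≡ , a≡ = normalForm-injective eq in
                       remQuot-injective {p} N _ _ (≡.cong₂ _,_ j≡ (digits-injective μ a≡)))
                  , surjective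
      }
      where
      N = product μ
      enumerate : Fin (p ℕ.* N) → W.Carrier
      enumerate k = normalForm (proj₁ (remQuot {p} N k)) (digits μ (proj₂ (remQuot {p} N k)))
      surjective : ∀ w → ∃[ k ] (∀ {l} → l ≡ k → enumerate l W.≈ w)
      surjective w with reduced w
      ... | j , a , eq with digits-surjective μ a
      ...   | k , k-digits = combine j k , λ { ≡.refl → W.trans (W.reflexive (≡.cong
                (λ (j , k) → normalForm j (digits μ k)) (Fin.remQuot-combine j k)))
                (W.trans (W.∙-congˡ (W.∏-cong {suc n} λ i →
                   W.reflexive (≡.cong (λ b → S i W.^ toℕ b) (k-digits i)))) (W.sym eq)) }
      -- The factor p counts the powers of β, and p ∸ r ∸ 1 is the number of generators of order
      -- p^(e-1).
      count : p ℕ.* N ≡ p ℕ.^ (e ℕ.* r ℕ.+ (e ∸ 1) ℕ.* (p ∸ r ∸ 1) ℕ.+ 1)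
      count = ≡.trans (≡.cong (p ℕ.*_) (product-^-exponent p e r (suc n) r≤n))
        (≡.cong (p ℕ.^_) (≡.trans (ℕ.+-comm 1 _)
          (≡.cong (λ k → e ℕ.* r ℕ.+ (e ∸ 1) ℕ.* k ℕ.+ 1) (≡.sym
            (≡.trans (ℕ.∸-+-assoc p r 1) (≡.cong (p ∸_) (ℕ.+-comm r 1)))))))

-- The regular polytope

odd : ℕ → Bool
odd zero    = false
odd (suc k) = not (odd k)

odd-+2 : ∀ k → odd (2+ k) ≡ odd k
odd-+2 k with odd k
... | true  = ≡.refl
... | false = ≡.refl

even⇒2∣ : ∀ k → odd k ≡ false → 2 ℕ∣.∣ k
even⇒2∣ zero     _  = ℕ∣.divides 0 ≡.refl
even⇒2∣ (2+ k)   eq = ℕ∣.∣m∣n⇒∣m+n ℕ∣.∣-refl (even⇒2∣ k (≡.trans (≡.sym (odd-+2 k)) eq))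

-- What the string C-group uses of G: two generators a and b, with b and ab⁻¹ killed by p, and
-- characters to ℤ/p with arbitrary values at a and b.
module Polytope
  (Γ : Group 0ℓ 0ℓ) (p : ℕ) (pp : Prime p) (p≢2 : p ≢ 2) (a b : Group.Carrier Γ)
  (generated : ∀ x → x ∈ ⟨_⟩ Γ (λ y → (Group._≈_ Γ y a) ⊎ (Group._≈_ Γ y b)))
  (b^p≈ε : Group._≈_ Γ (GroupOps._^_ (Group.rawGroup Γ) b p) (Group.ε Γ))
  ([ab⁻¹]^p≈ε : Group._≈_ Γ (GroupOps._^_ (Group.rawGroup Γ) (Group._∙_ Γ a (Group._⁻¹ Γ b)) p) (Group.ε Γ))
  (χ : ℤ → ℤ → Group.Carrier Γ → ℤ)
  (χ-homo : ∀ x y → IsGroupHomomorphism (Group.rawGroup Γ) (AbelianGroup.rawGroup (ℤmod p)) (χ x y))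
  (χ-a : ∀ x y → χ x y a ≡ x) (χ-b : ∀ x y → χ x y b ≡ y)
  (σ τ : Automorphism Γ)
  (σa : Group._≈_ Γ (Automorphism.⟦_⟧ σ a) a)
  (σb : Group._≈_ Γ (Automorphism.⟦_⟧ σ b) (Group._⁻¹ Γ b))
  (τa : Group._≈_ Γ (Automorphism.⟦_⟧ τ a) (Group._⁻¹ Γ a))
  (τb : Group._≈_ Γ (Automorphism.⟦_⟧ τ b) b)
  where

  open Group Γ using (Carrier; _≈_)
  open Automorphism using (⟦_⟧; ⟦⟧-cong; ∙-homo; ε-homo; ⁻¹-homo; isGroupHomomorphism)
  private
    module Γ where
      open Group Γ public
      open GroupOps rawGroup public
      open GroupLemmas Γ public
      open GroupProperties Γ public
      open Mult monoid public using (×-assocˡ; ×-congʳ; ×-homo-1)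
    module Aut = Group (Aut Γ)
    module Z = AbelianGroup (ℤmod p)
    module χ x y = IsGroupHomomorphism (χ-homo x y)

  instance
    p-nonZero : NonZero p
    p-nonZero = prime⇒nonZero pp

  2<p : 2 < p
  2<p = ℕ.≤∧≢⇒< (ℕ.nonTrivial⇒n>1 p {{prime⇒nonTrivial pp}}) (p≢2 ∘ ≡.sym)

  odd-p : odd p ≡ true
  odd-p with odd p in eq
  ... | true  = ≡.refl
  ... | false with prime⇒irreducible pp (even⇒2∣ p eq)
  ...   | inj₂ 2≡p = contradiction (≡.sym 2≡p) p≢2

  1≢-1 : ¬ (+ 1 ≡ -[1+ 0 ] [mod p ])
  1≢-1 eq = ℕ∣.>⇒∤ 2<p (≡mod⇒∣ eq)

  1≢0 : ¬ (+ 1 ≡ + 0 [mod p ])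
  1≢0 eq = ℕ∣.>⇒∤ (ℕ.<-trans (ℕ.n<1+n 1) 2<p) (≡mod⇒∣ eq)

  χ-^ : ∀ x y u k → χ x y (u Γ.^ k) ≡ + k ℤ.* χ x y u [mod p ]
  χ-^ x y u k = Z.trans (^-homo {G = Γ} {H = Z.group} (χ-homo x y) u k) (≡⇒≡mod (ℤmod-^ {p} (χ x y u) k))

  χ-b^ : ∀ x k → χ x (+ 1) (b Γ.^ k) ≡ + k [mod p ]
  χ-b^ x k = Z.trans (χ-^ x (+ 1) b k)
    (≡⇒≡mod (≡.trans (≡.cong (+ k ℤ.*_) (χ-b x (+ 1))) (ℤ.*-identityʳ (+ k))))

  χ-ε : ∀ x y → χ x y Γ.ε ≡ + 0 [mod p ]
  χ-ε x y = χ.ε-homo x y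

  χ-cong : ∀ x y {u v} → u ≈ v → χ x y u ≡ χ x y v [mod p ]
  χ-cong x y = χ.⟦⟧-cong x y

  signed : Bool → Carrier → Carrier
  signed false u = u
  signed true  u = u Γ.⁻¹

  signed-cong : ∀ i {u v} → u ≈ v → signed i u ≈ signed i v
  signed-cong false eq = eq
  signed-cong true  eq = Γ.⁻¹-cong eq

  signed-signed : ∀ i j u → signed j (signed i u) ≈ signed (i xor j) u
  signed-signed false j     u = Γ.refl
  signed-signed true  false u = Γ.refl
  signed-signed true  true  u = Γ.⁻¹-involutive u

  signed-homo : ∀ (f : Automorphism Γ) i u → ⟦ f ⟧ (signed i u) ≈ signed i (⟦ f ⟧ u)
  signed-homo f false u = Γ.refl
  signed-homo f true  u = ⁻¹-homo f u

  -- A character with value 1 at `u` has value -1 at the inverse of `u`, and these differ because p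
  -- is odd.
  signed-injective : ∀ {u} x y → χ x y u ≡ + 1 → ∀ i j → signed i u ≈ signed j u → i ≡ j
  signed-injective x y χu false false eq = ≡.refl
  signed-injective x y χu true  true  eq = ≡.refl
  signed-injective {u} x y χu false true  eq = contradiction
    (≡.subst (λ k → k ≡ ℤ.- k [mod p ]) χu (Z.trans (χ-cong x y eq) (χ.⁻¹-homo x y u))) 1≢-1
  signed-injective {u} x y χu true  false eq = contradiction
    (≡.subst (λ k → k ≡ ℤ.- k [mod p ]) χu
      (Z.trans (χ-cong x y (Γ.sym eq)) (χ.⁻¹-homo x y u))) 1≢-1

  -- The bit `true` stands for inversion, and the sign at b comes first: σ has signs (true, false)
  -- and τ has (false, true). Signs compose by `xor` and determine the automorphism, as a and b
  -- generate.
  record Signs (f : Automorphism Γ) (i j : Bool) : Set where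
    constructor signs
    field
      on-b : ⟦ f ⟧ b ≈ signed i b
      on-a : ⟦ f ⟧ a ≈ signed j a

  open Signs

  automorphism-ext : ∀ {i j} f g → Signs f i j → Signs g i j → f Aut.≈ g
  automorphism-ext f g (signs fb fa) (signs gb ga) x = homo-agree {G = Γ} {H = Γ}
    (isGroupHomomorphism f) (isGroupHomomorphism g)
    (λ { (inj₁ eq) → agree eq fa ga ; (inj₂ eq) → agree eq fb gb })
    (generated x)
    where
    agree : ∀ {x u v} → x ≈ u → ⟦ f ⟧ u ≈ v → ⟦ g ⟧ u ≈ v → ⟦ f ⟧ x ≈ ⟦ g ⟧ x
    agree eq fu gu = Γ.trans (⟦⟧-cong f eq) (Γ.trans fu (Γ.sym (Γ.trans (⟦⟧-cong g eq) gu)))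

  signs-∙ : ∀ f g {i j k l} → Signs f i j → Signs g k l → Signs (f Aut.∙ g) (i xor k) (j xor l)
  signs-∙ f g {i} {j} {k} {l} (signs fb fa) (signs gb ga) = signs (compose i k fb gb) (compose j l fa ga)
    where
    compose : ∀ i j {u} → ⟦ f ⟧ u ≈ signed i u → ⟦ g ⟧ u ≈ signed j u →
              ⟦ f ⟧ (⟦ g ⟧ u) ≈ signed (i xor j) u
    compose i j {u} fu gu = Γ.trans (⟦⟧-cong f gu) (Γ.trans (signed-homo f j u)
      (Γ.trans (signed-cong j fu) (signed-signed i j u)))

  signs-ε : Signs Aut.ε false false
  signs-ε = signs Γ.refl Γ.refl

  signs-σ : Signs σ true false
  signs-σ = signs σb σa

  signs-τ : Signs τ false true
  signs-τ = signs τb τa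

  στ : Automorphism Γ
  στ = σ Aut.∙ τ

  signs-στ : Signs στ true true
  signs-στ = signs-∙ σ τ signs-σ signs-τ

  signs-resp : ∀ {f g : Automorphism Γ} {i j} → f Aut.≈ g → Signs f i j → Signs g i j
  signs-resp eq (signs fb fa) = signs (Γ.trans (Γ.sym (eq b)) fb) (Γ.trans (Γ.sym (eq a)) fa)

  signs-unique : ∀ {f g i j k l} → f Aut.≈ g → Signs f i j → Signs g k l → i ≡ k × j ≡ l
  signs-unique {i = i} {j} {k} {l} eq (signs fb fa) (signs gb ga) =
    signed-injective (+ 0) (+ 1) (χ-b (+ 0) (+ 1)) i k (Γ.trans (Γ.sym fb) (Γ.trans (eq b) gb)) ,
    signed-injective (+ 1) (+ 0) (χ-a (+ 1) (+ 0)) j l (Γ.trans (Γ.sym fa) (Γ.trans (eq a) ga))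

  IsGenerator : Pred (Automorphism Γ) 0ℓ
  IsGenerator f = (f Aut.≈ σ) ⊎ (f Aut.≈ τ)

  K : Group 0ℓ 0ℓ
  K = GeneratedSubgroup (Aut Γ) IsGenerator

  private module K = Group K

  has-signs : ∀ {f} → f ∈ ⟨_⟩ (Aut Γ) IsGenerator → ∃[ i ] ∃[ j ] Signs f i j
  has-signs {f} (gen (inj₁ eq)) = true , false , signs-resp {σ} {f} (λ x → Γ.sym (eq x)) signs-σ
  has-signs {f} (gen (inj₂ eq)) = false , true , signs-resp {τ} {f} (λ x → Γ.sym (eq x)) signs-τ
  has-signs ε∈ = false , false , signs-ε
  has-signs (∙∈ {f} {g} f∈ g∈) with has-signs f∈ | has-signs g∈
  ... | i , j , fs | k , l , gs = i xor k , j xor l , signs-∙ f g fs gs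
  has-signs (⁻¹∈ {f} f∈) with has-signs f∈
  ... | i , j , signs fb fa = i , j , signs (invert i fb) (invert j fa)
    where
    xor-self : ∀ i → i xor i ≡ false
    xor-self false = ≡.refl
    xor-self true  = ≡.refl
    invert : ∀ i {u} → ⟦ f ⟧ u ≈ signed i u → ⟦ f Aut.⁻¹ ⟧ u ≈ signed i u
    invert i {u} fu = Automorphism.injective f (Γ.trans (Aut.inverseʳ f u) (Γ.sym
      (Γ.trans (signed-homo f i u) (Γ.trans (signed-cong i fu)
        (Γ.trans (signed-signed i i u) (Γ.reflexive (≡.cong (λ k → signed k u) (xor-self i))))))))
  has-signs (resp {f} {g} eq f∈) with has-signs f∈
  ... | i , j , fs = i , j , signs-resp {f} {g} eq fs

  σ∈ : σ ∈ ⟨_⟩ (Aut Γ) IsGenerator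
  σ∈ = gen (inj₁ λ _ → Γ.refl)

  τ∈ : τ ∈ ⟨_⟩ (Aut Γ) IsGenerator
  τ∈ = gen (inj₂ λ _ → Γ.refl)

  klein : Fin 4 → K.Carrier
  klein 0F = Aut.ε , ε∈
  klein 1F = σ , σ∈
  klein 2F = τ , τ∈
  klein 3F = στ , ∙∈ σ∈ τ∈

  bits : Fin 4 → Bool × Bool
  bits 0F = false , false
  bits 1F = true , false
  bits 2F = false , true
  bits 3F = true , true

  index : Bool → Bool → Fin 4
  index false false = 0F
  index true  false = 1F
  index false true  = 2F
  index true  true  = 3F

  index-bits : ∀ k → index (proj₁ (bits k)) (proj₂ (bits k)) ≡ k
  index-bits 0F = ≡.refl
  index-bits 1F = ≡.refl
  index-bits 2F = ≡.refl
  index-bits 3F = ≡.refl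

  bits-index : ∀ i j → bits (index i j) ≡ (i , j)
  bits-index false false = ≡.refl
  bits-index true  false = ≡.refl
  bits-index false true  = ≡.refl
  bits-index true  true  = ≡.refl

  klein-signs : ∀ k → Signs (proj₁ (klein k)) (proj₁ (bits k)) (proj₂ (bits k))
  klein-signs 0F = signs-ε
  klein-signs 1F = signs-σ
  klein-signs 2F = signs-τ
  klein-signs 3F = signs-στ

  klein-index-signs : ∀ i j → Signs (proj₁ (klein (index i j))) i j
  klein-index-signs i j = ≡.subst (λ (k , l) → Signs (proj₁ (klein (index i j))) k l)
    (bits-index i j) (klein-signs (index i j))

  klein-injective : ∀ {k l} → proj₁ (klein k) Aut.≈ proj₁ (klein l) → k ≡ l
  klein-injective {k} {l} eq =
    let (i≡ , j≡) = signs-unique {proj₁ (klein k)} {proj₁ (klein l)} eq (klein-signs k) (klein-signs l)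
    in ≡.trans (≡.sym (index-bits k)) (≡.trans (≡.cong₂ index i≡ j≡) (index-bits l))

  klein-surjective : ∀ {f} → f ∈ ⟨_⟩ (Aut Γ) IsGenerator → ∃[ k ] proj₁ (klein k) Aut.≈ f
  klein-surjective {f} f∈ =
    let (i , j , fs) = has-signs f∈
    in index i j , automorphism-ext (proj₁ (klein (index i j))) f (klein-index-signs i j) fs

  -- The semidirect product and its three involutions

  R₀ : Group 0ℓ 0ℓ
  R₀ = Γ ⋊⟨ IsGenerator ⟩

  private module R where
    open Group R₀ public
    open GroupOps rawGroup public

  R-order : ∀ {N} → GroupOrder Γ N → GroupOrder R₀ (4 ℕ.* N)
  R-order {N} Γ-order = record
    { to = to
    ; cong = λ { {k} ≡.refl → R.refl {to k} }
    ; bijective = (λ {k} {l} (g≈ , f≈) → remQuot-injective {4} N k l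
                    (≡.cong₂ _,_ (klein-injective f≈) (Γ-order.injective g≈)))
                , λ (g , f , f∈) → surjective g f f∈
    }
    where
    module Γ-order = Bijection Γ-order
    to : Fin (4 ℕ.* N) → R.Carrier
    to k = Γ-order.to (proj₂ (remQuot {4} N k)) , klein (proj₁ (remQuot {4} N k))
    surjective : ∀ g f (f∈ : f ∈ ⟨_⟩ (Aut Γ) IsGenerator) →
                 ∃[ k ] (∀ {l} → l ≡ k → to l R.≈ (g , f , f∈))
    surjective g f f∈ =
      let (i , f≈) = klein-surjective f∈
          (j , g≈) = Γ-order.surjective g
          split = Fin.remQuot-combine i j
      in combine i j , λ { ≡.refl →
           Γ.trans (Γ.reflexive (≡.cong (Γ-order.to ∘ proj₂) split)) (g≈ ≡.refl) ,
           λ x → Γ.trans (Γ.reflexive (≡.cong (λ k → ⟦ proj₁ (klein (proj₁ k)) ⟧ x) split)) (f≈ x) }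

  -- Equality of automorphisms is replaced by equality of signs, so that equations in R₀ amount to
  -- equations in Γ and a computation with bits.
  R-≈ : ∀ {g h} {f f′ : Automorphism Γ} {i j} →
        g ≈ h → Signs f i j → Signs f′ i j → g ≈ h × f Aut.≈ f′
  R-≈ {f = f} {f′} g≈h fs f′s = g≈h , automorphism-ext f f′ fs f′s

  -- As στ inverts both a and b, the squares of a·στ and b·στ are aa⁻¹ and bb⁻¹. As σ fixes a and
  -- commutes with στ, it commutes with a·στ.
  ρ : Fin 3 → R.Carrier
  ρ 0F = a , klein 3F
  ρ 1F = b , klein 3F
  ρ 2F = Γ.ε , klein 1F

  στ-inverts-a : ⟦ στ ⟧ a ≈ a Γ.⁻¹
  στ-inverts-a = on-a signs-στ

  στ-inverts-b : ⟦ στ ⟧ b ≈ b Γ.⁻¹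
  στ-inverts-b = on-b signs-στ

  ρ² : ∀ i → ρ i R.∙ ρ i R.≈ R.ε
  ρ² 0F = R-≈ (Γ.trans (Γ.∙-congˡ στ-inverts-a) (Γ.inverseʳ a)) (signs-∙ στ στ signs-στ signs-στ) signs-ε
  ρ² 1F = R-≈ (Γ.trans (Γ.∙-congˡ στ-inverts-b) (Γ.inverseʳ b)) (signs-∙ στ στ signs-στ signs-στ) signs-ε
  ρ² 2F = R-≈ (Γ.trans (Γ.identityˡ _) (ε-homo σ)) (signs-∙ σ σ signs-σ signs-σ) signs-ε

  -- All three automorphisms invert b, which shows uniformly that none of the `ρ i` is the identity.
  ρ-b-sign : ∀ i → ⟦ proj₁ (proj₂ (ρ i)) ⟧ b ≈ b Γ.⁻¹
  ρ-b-sign 0F = στ-inverts-b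
  ρ-b-sign 1F = στ-inverts-b
  ρ-b-sign 2F = σb

  b≉b⁻¹ : ¬ (b Γ.⁻¹ ≈ b)
  b≉b⁻¹ eq with () ← signed-injective (+ 0) (+ 1) (χ-b (+ 0) (+ 1)) true false eq

  ρ-involution : ∀ i → R.Involution (ρ i)
  ρ-involution i = record
    { positive = ℕ.z<s
    ; power    = R.trans {ρ i R.^ 2} {ρ i R.∙ ρ i} {R.ε}
                   (R.∙-congˡ {ρ i} {ρ i R.∙ R.ε} {ρ i} (R.identityʳ (ρ i))) (ρ² i)
    ; minimal  = λ where
        1 _ _ (_ , eq) → b≉b⁻¹ (Γ.trans (Γ.sym (ρ-b-sign i)) (eq b))
        (2+ k) _ (s≤s (s≤s ()))
    }

  ρ₀ρ₂-commute : ρ 0F R.∙ ρ 2F R.≈ ρ 2F R.∙ ρ 0F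
  ρ₀ρ₂-commute = R-≈
    (Γ.trans (Γ.∙-congˡ (ε-homo στ)) (Γ.trans (Γ.identityʳ a)
      (Γ.sym (Γ.trans (Γ.identityˡ _) σa))))
    (signs-∙ στ σ signs-στ signs-σ) (signs-∙ σ στ signs-σ signs-στ)

  ρ-string : ∀ i j → 1 < ℕ.∣ toℕ i - toℕ j ∣ → ρ i R.∙ ρ j R.≈ ρ j R.∙ ρ i
  ρ-string 0F 2F _ = ρ₀ρ₂-commute
  ρ-string 2F 0F _ = R.sym {ρ 0F R.∙ ρ 2F} {ρ 2F R.∙ ρ 0F} ρ₀ρ₂-commute
  ρ-string 0F 0F ()
  ρ-string 0F 1F (s≤s ())
  ρ-string 1F 0F (s≤s ())
  ρ-string 1F 1F ()
  ρ-string 1F 2F (s≤s ())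
  ρ-string 2F 1F (s≤s ())
  ρ-string 2F 2F ()

  -- The orders of ρ₀ρ₁ and ρ₁ρ₂

  ^-first : ∀ g f (f∈ : f ∈ ⟨_⟩ (Aut Γ) IsGenerator) → ⟦ f ⟧ g ≈ g →
            ∀ k → proj₁ ((g , f , f∈) R.^ k) ≈ g Γ.^ k
  ^-first g f f∈ fg zero    = Γ.refl
  ^-first g f f∈ fg (suc k) = Γ.∙-congˡ (Γ.trans (⟦⟧-cong f (^-first g f f∈ fg k))
    (Γ.trans (^-homo {G = Γ} {H = Γ} (isGroupHomomorphism f) g k) (Γ.×-congʳ k fg)))

  ρ₀ρ₁-first : ∀ k → proj₁ ((ρ 0F R.∙ ρ 1F) R.^ k) ≈ (a Γ.∙ b Γ.⁻¹) Γ.^ k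
  ρ₀ρ₁-first k = Γ.trans
    (^-first (a Γ.∙ ⟦ στ ⟧ b) (στ Aut.∙ στ) (proj₂ (proj₂ (ρ 0F R.∙ ρ 1F)))
      (automorphism-ext (στ Aut.∙ στ) Aut.ε (signs-∙ στ στ signs-στ signs-στ) signs-ε _) k)
    (Γ.×-congʳ k (Γ.∙-congˡ στ-inverts-b))

  ρ₀ρ₁-signs : ∀ k → Signs (proj₁ (proj₂ ((ρ 0F R.∙ ρ 1F) R.^ k))) false false
  ρ₀ρ₁-signs zero    = signs-ε
  ρ₀ρ₁-signs (suc k) = signs-∙ (στ Aut.∙ στ) (proj₁ (proj₂ ((ρ 0F R.∙ ρ 1F) R.^ k)))
    (signs-∙ στ στ signs-στ signs-στ) (ρ₀ρ₁-signs k)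

  -- The character with values 1 at a and 0 at b is 1 at ab⁻¹, so no power of ab⁻¹ below the p-th is
  -- trivial.
  χ-ab⁻¹^ : ∀ k → χ (+ 1) (+ 0) ((a Γ.∙ b Γ.⁻¹) Γ.^ k) ≡ + k [mod p ]
  χ-ab⁻¹^ k = Z.trans (χ-^ (+ 1) (+ 0) (a Γ.∙ b Γ.⁻¹) k) (Z.trans
    (scale k (Z.trans (χ.homo (+ 1) (+ 0) a (b Γ.⁻¹)) (Z.∙-cong (≡⇒≡mod (χ-a (+ 1) (+ 0)))
      (Z.trans (χ.⁻¹-homo (+ 1) (+ 0) b) (Z.⁻¹-cong (≡⇒≡mod (χ-b (+ 1) (+ 0))))))))
    (≡⇒≡mod (ℤ.*-identityʳ (+ k))))
    where
    scale : ∀ k {x y} → x ≡ y [mod p ] → + k ℤ.* x ≡ + k ℤ.* y [mod p ]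
    scale k = *-cong-mod {a = k} (ℕ∣.n∣m*n k)

  ρ₀ρ₁-order : R.ElementOrder (ρ 0F R.∙ ρ 1F) p
  ρ₀ρ₁-order = record
    { positive = ℕ.<-trans ℕ.z<s 2<p
    ; power    = R-≈ (Γ.trans (ρ₀ρ₁-first p) [ab⁻¹]^p≈ε) (ρ₀ρ₁-signs p) signs-ε
    ; minimal  = λ where
        k@(suc _) _ k<p (eq , _) → ℕ∣.>⇒∤ k<p (≡0mod⇒∣
          (Z.trans (Z.sym (χ-ab⁻¹^ k)) (Z.trans
            (χ-cong (+ 1) (+ 0) (Γ.trans (Γ.sym (ρ₀ρ₁-first k)) eq)) (χ-ε (+ 1) (+ 0)))))
    }

  u : R.Carrier
  u = ρ 1F R.∙ ρ 2F

  u-signs : ∀ k → Signs (proj₁ (proj₂ (u R.^ k))) false (odd k)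
  u-signs zero    = signs-ε
  u-signs (suc k) = signs-∙ (στ Aut.∙ σ) (proj₁ (proj₂ (u R.^ k)))
    (signs-∙ στ σ signs-στ signs-σ) (u-signs k)

  -- `u` is bτ, and τ fixes b, so the components of its k-th power are simply bᵏ and τᵏ.
  u-first : ∀ k → proj₁ (u R.^ k) ≈ b Γ.^ k
  u-first k = Γ.trans
    (^-first (b Γ.∙ ⟦ στ ⟧ Γ.ε) (στ Aut.∙ σ) (proj₂ (proj₂ u))
      (Γ.trans (⟦⟧-cong (στ Aut.∙ σ) b∙≈b) (Γ.trans (on-b (signs-∙ στ σ signs-στ signs-σ)) (Γ.sym b∙≈b))) k)
    (Γ.×-congʳ k b∙≈b)
    where
    b∙≈b : b Γ.∙ ⟦ στ ⟧ Γ.ε ≈ b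
    b∙≈b = Γ.trans (Γ.∙-congˡ (ε-homo στ)) (Γ.identityʳ b)

  b^≈ε⇒p∣ : ∀ k → b Γ.^ k ≈ Γ.ε → p ℕ∣.∣ k
  b^≈ε⇒p∣ k eq = ≡0mod⇒∣ (Z.trans (Z.sym (χ-b^ (+ 0) k)) (Z.trans (χ-cong (+ 0) (+ 1) eq) (χ-ε (+ 0) (+ 1))))

  odd-+ : ∀ k l → odd (k ℕ.+ l) ≡ odd k xor odd l
  odd-+ zero    l = ≡.refl
  odd-+ (suc k) l with odd k | odd-+ k l
  ... | true  | eq = ≡.trans (≡.cong not eq) (not-not (odd l))
    where
    not-not : ∀ x → not (not x) ≡ x
    not-not true  = ≡.refl
    not-not false = ≡.refl
  ... | false | eq = ≡.cong not eq

  odd-2p : odd (2 ℕ.* p) ≡ false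
  odd-2p = ≡.trans (odd-+ p (p ℕ.+ 0)) (≡.cong₂ _xor_ odd-p (≡.trans (≡.cong odd (ℕ.+-identityʳ p)) odd-p))

  -- A trivial power bᵏ needs p to divide k and a trivial τᵏ needs k to be even; the multiple p
  -- itself is excluded because it is odd.
  even-multiple-≥2p : ∀ {k} → p ℕ∣.∣ k → 0 < k → odd k ≡ false → 2 ℕ.* p ≤ k
  even-multiple-≥2p (ℕ∣.divides 1 ≡.refl) _ even = contradiction
    (≡.trans (≡.sym odd-p) (≡.trans (≡.cong odd (≡.sym (ℕ.*-identityˡ p))) even)) λ ()
  even-multiple-≥2p (ℕ∣.divides (2+ q) ≡.refl) _ _ = ℕ.*-monoˡ-≤ p {2} {2+ q} (s≤s (s≤s z≤n))

  u^-action : ℕ → Automorphism Γ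
  u^-action k = proj₁ (proj₂ (u R.^ k))

  u^2p≈ε : u R.^ (2 ℕ.* p) R.≈ R.ε
  u^2p≈ε = R-≈ {f = u^-action (2 ℕ.* p)} {f′ = Aut.ε}
    (Γ.trans (u-first (2 ℕ.* p)) (Γ.^-order-* {b} {p} b^p≈ε 2))
    (≡.subst (Signs (u^-action (2 ℕ.* p)) false) odd-2p (u-signs (2 ℕ.* p))) signs-ε

  ρ₁ρ₂-order : R.ElementOrder u (2 ℕ.* p)
  ρ₁ρ₂-order = record
    { positive = ℕ.<-≤-trans (ℕ.<-trans ℕ.z<s 2<p) (ℕ.m≤m+n p (p ℕ.+ 0))
    ; power    = u^2p≈ε
    ; minimal  = λ k 0<k k<2p (g≈ , f≈) → ℕ.<⇒≱ k<2p (even-multiple-≥2p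
        (b^≈ε⇒p∣ k (Γ.trans (Γ.sym (u-first k)) g≈)) 0<k
        (proj₂ (signs-unique {u^-action k} {Aut.ε} f≈ (u-signs k) signs-ε)))
    }

  -- Generation of the semidirect product by the involutions

  IsRho : Pred R.Carrier 0ℓ
  IsRho y = ∃[ i ] y R.≈ ρ i

  ρ∈ : ∀ i → ρ i ∈ ⟨_⟩ R₀ IsRho
  ρ∈ i = gen (i , R.refl {ρ i})

  ^∈ : ∀ {x} → x ∈ ⟨_⟩ R₀ IsRho → ∀ k → x R.^ k ∈ ⟨_⟩ R₀ IsRho
  ^∈ x∈ zero    = ε∈
  ^∈ x∈ (suc k) = ∙∈ x∈ (^∈ x∈ k)

  -- (ρ₁ρ₂)ᵖ is τ, because b has odd order p and τ is an involution.
  τ∈⟨ρ⟩ : (Γ.ε , klein 2F) ∈ ⟨_⟩ R₀ IsRho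
  τ∈⟨ρ⟩ = resp (R-≈ (Γ.trans (u-first p) b^p≈ε) (≡.subst (Signs (u^-action p) false) odd-p (u-signs p)) signs-τ)
            (^∈ (∙∈ (ρ∈ 1F) (ρ∈ 2F)) p)

  klein∈⟨ρ⟩ : ∀ k → (Γ.ε , klein k) ∈ ⟨_⟩ R₀ IsRho
  klein∈⟨ρ⟩ 0F = resp (R-≈ Γ.refl signs-ε signs-ε) ε∈
  klein∈⟨ρ⟩ 1F = ρ∈ 2F
  klein∈⟨ρ⟩ 2F = τ∈⟨ρ⟩
  klein∈⟨ρ⟩ 3F = resp (R-≈ (Γ.trans (Γ.identityˡ _) (ε-homo σ)) signs-στ signs-στ) (∙∈ (ρ∈ 2F) τ∈⟨ρ⟩)

  -- Multiplying ρ₀ and ρ₁ by στ on the right strips off their automorphism parts and leaves a and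
  -- b.
  Γ∈⟨ρ⟩ : ∀ {g} → g ∈ ⟨_⟩ Γ (λ y → (y ≈ a) ⊎ (y ≈ b)) → (g , klein 0F) ∈ ⟨_⟩ R₀ IsRho
  Γ∈⟨ρ⟩ (gen (inj₁ eq)) = resp (R-≈
      (Γ.trans (Γ.trans (Γ.∙-congˡ (ε-homo στ)) (Γ.identityʳ a)) (Γ.sym eq))
      (signs-∙ στ στ signs-στ signs-στ) signs-ε)
    (∙∈ (ρ∈ 0F) (klein∈⟨ρ⟩ 3F))
  Γ∈⟨ρ⟩ (gen (inj₂ eq)) = resp (R-≈
      (Γ.trans (Γ.trans (Γ.∙-congˡ (ε-homo στ)) (Γ.identityʳ b)) (Γ.sym eq))
      (signs-∙ στ στ signs-στ signs-στ) signs-ε)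
    (∙∈ (ρ∈ 1F) (klein∈⟨ρ⟩ 3F))
  Γ∈⟨ρ⟩ ε∈ = klein∈⟨ρ⟩ 0F
  Γ∈⟨ρ⟩ (∙∈ x∈ y∈) = resp (R-≈ Γ.refl signs-ε signs-ε) (∙∈ (Γ∈⟨ρ⟩ x∈) (Γ∈⟨ρ⟩ y∈))
  Γ∈⟨ρ⟩ (⁻¹∈ x∈) = resp (R-≈ Γ.refl signs-ε signs-ε) (⁻¹∈ (Γ∈⟨ρ⟩ x∈))
  Γ∈⟨ρ⟩ (resp eq x∈) = resp (R-≈ eq signs-ε signs-ε) (Γ∈⟨ρ⟩ x∈)

  ρ-generates : ∀ x → x ∈ ⟨_⟩ R₀ IsRho
  ρ-generates (g , f , f∈) =
    let (k , k≈f) = klein-surjective f∈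
    in resp (Γ.identityʳ g , k≈f) (∙∈ (Γ∈⟨ρ⟩ (generated g)) (klein∈⟨ρ⟩ k))

  -- The intersection property

  ψ : Carrier → ℤ
  ψ = χ (+ 1) (+ 1)

  -- Since στ inverts both generators, it negates every character. The choice of `ψ`, equal to 1 at
  -- a and at b, is made so that it kills the rotation ab⁻¹ of ⟨ρ₀, ρ₁⟩ while still counting powers
  -- of b.
  ψ-στ : ∀ g → ψ (⟦ στ ⟧ g) ≡ ℤ.- ψ g [mod p ]
  ψ-στ g = homo-agree {G = Γ} {H = Z.group}
    (mkGroupHom {G = Γ} {H = Z.group} (ψ ∘ ⟦ στ ⟧) (χ-cong _ _ ∘ ⟦⟧-cong στ)
      (λ x y → Z.trans (χ-cong _ _ (∙-homo στ x y)) (χ.homo _ _ (⟦ στ ⟧ x) (⟦ στ ⟧ y))))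
    (mkGroupHom {G = Γ} {H = Z.group} (λ x → ℤ.- ψ x) (Z.⁻¹-cong ∘ χ-cong _ _)
      (λ x y → Z.trans (Z.⁻¹-cong (χ.homo _ _ x y)) (≡⇒≡mod (ℤ.neg-distrib-+ (ψ x) (ψ y)))))
    (λ { (inj₁ eq) → agree στ-inverts-a eq ; (inj₂ eq) → agree στ-inverts-b eq })
    (generated g)
    where
    agree : ∀ {x c} → ⟦ στ ⟧ c ≈ c Γ.⁻¹ → x ≈ c → ψ (⟦ στ ⟧ x) ≡ ℤ.- ψ x [mod p ]
    agree {x} {c} inverts eq = Z.trans
      (χ-cong _ _ (Γ.trans (⟦⟧-cong στ eq) (Γ.trans inverts (Γ.⁻¹-cong (Γ.sym eq))))) (χ.⁻¹-homo _ _ x)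

  -- Qᵢⱼ contains ⟨ρᵢ, ρⱼ⟩ and is just strong enough to recognise the intersections.
  Q₀₁ Q₁₂ Q₀₂ : Pred R.Carrier 0ℓ
  Q₀₁ (g , f , _) = (Signs f false false × ψ g ≡ + 0 [mod p ]) ⊎ (Signs f true true × ψ g ≡ + 1 [mod p ])
  Q₁₂ (g , _)     = ∃[ k ] g ≈ b Γ.^ k
  Q₀₂ (g , f , _) = ∃[ i ] (Signs f i false × g ≈ Γ.ε ⊎ Signs f i true × g ≈ a)

  Q₀₁-resp : ∀ {x y} → x R.≈ y → x ∈ Q₀₁ → y ∈ Q₀₁
  Q₀₁-resp {_ , f , _} {_ , f′ , _} (g≈ , f≈) (inj₁ (fs , ψg)) =
    inj₁ (signs-resp {f} {f′} f≈ fs , Z.trans (χ-cong _ _ (Γ.sym g≈)) ψg)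
  Q₀₁-resp {_ , f , _} {_ , f′ , _} (g≈ , f≈) (inj₂ (fs , ψg)) =
    inj₂ (signs-resp {f} {f′} f≈ fs , Z.trans (χ-cong _ _ (Γ.sym g≈)) ψg)

  Q₁₂-resp : ∀ {x y} → x R.≈ y → x ∈ Q₁₂ → y ∈ Q₁₂
  Q₁₂-resp (g≈ , _) (k , eq) = k , Γ.trans (Γ.sym g≈) eq

  Q₀₂-resp : ∀ {x y} → x R.≈ y → x ∈ Q₀₂ → y ∈ Q₀₂
  Q₀₂-resp {_ , f , _} {_ , f′ , _} (g≈ , f≈) (i , inj₁ (fs , eq)) =
    i , inj₁ (signs-resp {f} {f′} f≈ fs , Γ.trans (Γ.sym g≈) eq)
  Q₀₂-resp {_ , f , _} {_ , f′ , _} (g≈ , f≈) (i , inj₂ (fs , eq)) =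
    i , inj₂ (signs-resp {f} {f′} f≈ fs , Γ.trans (Γ.sym g≈) eq)

  -- Multiplication by c·στ turns ψ g into 1 - ψ g, so it exchanges the two alternatives, together
  -- with their signs.
  Q₀₁-step : ∀ {c} → ψ c ≡ + 1 → ∀ {y} → y ∈ Q₀₁ → (c , klein 3F) R.∙ y ∈ Q₀₁
  Q₀₁-step {c} ψc {g , f , _} (inj₁ (fs , ψg)) = inj₂ (signs-∙ στ f signs-στ fs ,
    Z.trans (χ.homo _ _ c (⟦ στ ⟧ g)) (Z.∙-cong (≡⇒≡mod ψc) (Z.trans (ψ-στ g) (Z.⁻¹-cong ψg))))
  Q₀₁-step {c} ψc {g , f , _} (inj₂ (fs , ψg)) = inj₁ (signs-∙ στ f signs-στ fs ,
    Z.trans (χ.homo _ _ c (⟦ στ ⟧ g)) (Z.∙-cong (≡⇒≡mod ψc) (Z.trans (ψ-στ g) (Z.⁻¹-cong ψg))))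

  -- `Q₁₂` allows only natural exponents, so b⁻ᵏ is written as the power of b with exponent k(p -
  -- 1).
  inverts-b^ : ∀ (f : Automorphism Γ) → ⟦ f ⟧ b ≈ b Γ.⁻¹ → ∀ k → ⟦ f ⟧ (b Γ.^ k) ≈ b Γ.^ (k ℕ.* ℕ.pred p)
  inverts-b^ f fb k = Γ.trans (^-homo {G = Γ} {H = Γ} (isGroupHomomorphism f) b k)
    (Γ.trans (Γ.×-congʳ k (Γ.trans fb (Γ.⁻¹≈^ p b^p≈ε))) (Γ.×-assocˡ b k (ℕ.pred p)))

  -- The first component is a exactly when the sign at a is `true`. Multiplication by ρ₀ exchanges
  -- the two cases, since aa⁻¹ is trivial; ρ₂ preserves them, since σ fixes a.
  Q₀₂-ρ₀ : ∀ {y} → y ∈ Q₀₂ → ρ 0F R.∙ y ∈ Q₀₂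
  Q₀₂-ρ₀ {g , f , _} (i , inj₁ (fs , eq)) = not i , inj₂ (signs-∙ στ f signs-στ fs ,
    Γ.trans (Γ.∙-congˡ (Γ.trans (⟦⟧-cong στ eq) (ε-homo στ))) (Γ.identityʳ a))
  Q₀₂-ρ₀ {g , f , _} (i , inj₂ (fs , eq)) = not i , inj₁ (signs-∙ στ f signs-στ fs ,
    Γ.trans (Γ.∙-congˡ (Γ.trans (⟦⟧-cong στ eq) στ-inverts-a)) (Γ.inverseʳ a))

  Q₀₂-ρ₂ : ∀ {y} → y ∈ Q₀₂ → ρ 2F R.∙ y ∈ Q₀₂
  Q₀₂-ρ₂ {g , f , _} (i , inj₁ (fs , eq)) = not i , inj₁ (signs-∙ σ f signs-σ fs ,
    Γ.trans (Γ.identityˡ _) (Γ.trans (⟦⟧-cong σ eq) (ε-homo σ)))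
  Q₀₂-ρ₂ {g , f , _} (i , inj₂ (fs , eq)) = not i , inj₂ (signs-∙ σ f signs-σ fs ,
    Γ.trans (Γ.identityˡ _) (Γ.trans (⟦⟧-cong σ eq) σa))

  Generators : Subset 3 → Pred R.Carrier 0ℓ
  Generators I x = ∃[ i ] (i ∈ₛ I × x R.≈ ρ i)

  -- Parabolic subgroups are generated by involutions, so `⟨⟩-left-induction` applies with one step
  -- for each `ρ i`.
  parabolic-induction : ∀ (I : Subset 3) (Q : Pred R.Carrier 0ℓ) →
    (∀ {x y} → x R.≈ y → x ∈ Q → y ∈ Q) → R.ε ∈ Q →
    (∀ i → i ∈ₛ I → ∀ {y} → y ∈ Q → ρ i R.∙ y ∈ Q) →
    ∀ {x} → x ∈ Parabolic R₀ ρ I → x ∈ Q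
  parabolic-induction I Q Q-resp Q-ε Q-step = GroupLemmas.⟨⟩-left-induction R₀ {P = Generators I}
    (λ {x} (i , _ , eq) → R.trans {x R.∙ x} {ρ i R.∙ ρ i} {R.ε} (R.∙-cong {x} {ρ i} {x} {ρ i} eq eq) (ρ² i))
    {Q = Q} (λ {x} {y} → Q-resp {x} {y})
    (λ {x} {y} (i , i∈ , eq) y∈ → Q-resp {ρ i R.∙ y} {x R.∙ y}
      (R.∙-congʳ {y} {ρ i} {x} (R.sym {x} {ρ i} eq)) (Q-step i i∈ {y} y∈))
    Q-ε

  -- The bits i and j are arbitrary, so this covers every subset that omits the index 2.
  in₀₁ : ∀ {i j x} → x ∈ Parabolic R₀ ρ (i ∷ j ∷ outside ∷ []) → x ∈ Q₀₁
  in₀₁ {x = x} = parabolic-induction _ Q₀₁ (λ {x} {y} → Q₀₁-resp {x} {y}) (inj₁ (signs-ε , χ-ε _ _))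
    (λ where
      0F _ {y} → Q₀₁-step (χ-a _ _) {y}
      1F _ {y} → Q₀₁-step (χ-b _ _) {y}
      2F (there (there ()))) {x}

  in₁₂ : ∀ {i j x} → x ∈ Parabolic R₀ ρ (outside ∷ i ∷ j ∷ []) → x ∈ Q₁₂
  in₁₂ {x = x} = parabolic-induction _ Q₁₂ (λ {x} {y} → Q₁₂-resp {x} {y}) (0 , Γ.refl)
    (λ where
      0F ()
      1F _ (k , eq) → suc (k ℕ.* ℕ.pred p) ,
        Γ.∙-congˡ (Γ.trans (⟦⟧-cong στ eq) (inverts-b^ στ στ-inverts-b k))
      2F _ (k , eq) → k ℕ.* ℕ.pred p ,
        Γ.trans (Γ.identityˡ _) (Γ.trans (⟦⟧-cong σ eq) (inverts-b^ σ σb k))) {x}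

  in₀₂ : ∀ {i j x} → x ∈ Parabolic R₀ ρ (i ∷ outside ∷ j ∷ []) → x ∈ Q₀₂
  in₀₂ {x = x} = parabolic-induction _ Q₀₂ (λ {x} {y} → Q₀₂-resp {x} {y}) (false , inj₁ (signs-ε , Γ.refl))
    (λ where
      0F _ {y} → Q₀₂-ρ₀ {y}
      1F (there ())
      2F _ {y} → Q₀₂-ρ₂ {y}) {x}

  TrivialOr : Fin 3 → R.Carrier → Set
  TrivialOr i x = x R.≈ R.ε ⊎ x R.≈ ρ i

  b^-reduce : ∀ k m → m < p → + k ≡ + m [mod p ] → b Γ.^ k ≈ b Γ.^ m
  b^-reduce k m m<p eq = Γ.trans (Γ.^-% p b^p≈ε k) (Γ.reflexive (≡.cong (b Γ.^_)
    (+-injective-mod (m%n<n k p) m<p (Z.trans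
      (Z.trans (Z.sym (χ-b^ (+ 0) (k % p))) (Z.trans
        (χ-cong (+ 0) (+ 1) (Γ.sym (Γ.^-% p b^p≈ε k))) (χ-b^ (+ 0) k))) eq))))

  -- On bᵏ the value of ψ is k modulo p. The two admissible values 0 and 1 therefore leave bᵏ = 1
  -- with trivial signs, and bᵏ = b with the signs of στ, which is ρ₁.
  Q₀₁∩Q₁₂ : ∀ {x} → x ∈ Q₀₁ → x ∈ Q₁₂ → TrivialOr 1F x
  Q₀₁∩Q₁₂ {g , f , _} (inj₁ (fs , ψg)) (k , eq) = inj₁ (R-≈ (Γ.trans eq (b^-reduce k 0 (ℕ.<-trans ℕ.z<s 2<p)
    (Z.trans (Z.sym (χ-b^ (+ 1) k)) (Z.trans (χ-cong _ _ (Γ.sym eq)) ψg)))) fs signs-ε)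
  Q₀₁∩Q₁₂ {g , f , _} (inj₂ (fs , ψg)) (k , eq) = inj₂ (R-≈ (Γ.trans (Γ.trans eq
    (b^-reduce k 1 (ℕ.<-trans (ℕ.n<1+n 1) 2<p)
      (Z.trans (Z.sym (χ-b^ (+ 1) k)) (Z.trans (χ-cong _ _ (Γ.sym eq)) ψg)))) (Γ.×-homo-1 b)) fs signs-στ)

  -- In `Q₀₁` both signs agree, so the sign at a, which in `Q₀₂` decides between 1 and a, fixes the
  -- sign at b as well.
  Q₀₁∩Q₀₂ : ∀ {x} → x ∈ Q₀₁ → x ∈ Q₀₂ → TrivialOr 0F x
  Q₀₁∩Q₀₂ (inj₁ (fs , _)) (i , inj₁ (fs′ , eq)) = inj₁ (R-≈ eq fs signs-ε)
  Q₀₁∩Q₀₂ (inj₂ (fs , _)) (i , inj₂ (fs′ , eq)) = inj₂ (R-≈ eq fs signs-στ)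
  Q₀₁∩Q₀₂ {_ , f , _} (inj₁ (fs , _)) (i , inj₂ (fs′ , _)) =
    contradiction (proj₂ (signs-unique {f} {f} (λ _ → Γ.refl) fs fs′)) λ ()
  Q₀₁∩Q₀₂ {_ , f , _} (inj₂ (fs , _)) (i , inj₁ (fs′ , _)) =
    contradiction (proj₂ (signs-unique {f} {f} (λ _ → Γ.refl) fs fs′)) λ ()

  a≉b^ : ∀ k → ¬ (a ≈ b Γ.^ k)
  a≉b^ k eq = 1≢0 (Z.trans (≡⇒≡mod (≡.sym (χ-a (+ 1) (+ 0)))) (Z.trans (χ-cong (+ 1) (+ 0) eq)
    (Z.trans (χ-^ (+ 1) (+ 0) b k) (≡⇒≡mod (≡.trans (≡.cong (+ k ℤ.*_) (χ-b (+ 1) (+ 0))) (ℤ.*-zeroʳ (+ k)))))))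

  -- A character that kills b but not a shows that a is no power of b. The first component is then
  -- trivial, and the sign at b distinguishes 1 from σ.
  Q₁₂∩Q₀₂ : ∀ {x} → x ∈ Q₁₂ → x ∈ Q₀₂ → TrivialOr 2F x
  Q₁₂∩Q₀₂ _ (false , inj₁ (fs , eq)) = inj₁ (R-≈ eq fs signs-ε)
  Q₁₂∩Q₀₂ _ (true  , inj₁ (fs , eq)) = inj₂ (R-≈ eq fs signs-σ)
  Q₁₂∩Q₀₂ (k , eqᵇ) (_ , inj₂ (fs , eq)) = contradiction (Γ.trans (Γ.sym eq) eqᵇ) (a≉b^ k)

  -- The first and third conditions leave only 1 and ρ₀, and the component a of ρ₀ is no power of b.
  Q₀₁∩Q₁₂∩Q₀₂ : ∀ {x} → x ∈ Q₀₁ → x ∈ Q₁₂ → x ∈ Q₀₂ → x R.≈ R.ε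
  Q₀₁∩Q₁₂∩Q₀₂ {x} q₀₁ q₁₂ q₀₂ with Q₀₁∩Q₀₂ {x} q₀₁ q₀₂ | q₁₂
  ... | inj₁ eq        | _        = eq
  ... | inj₂ (g≈a , _) | (k , eq) = contradiction (Γ.trans (Γ.sym g≈a) eq) (a≉b^ k)

  trivial∈ : ∀ I {x} → x R.≈ R.ε → x ∈ Parabolic R₀ ρ I
  trivial∈ I {x} eq = resp (R.sym {x} {R.ε} eq) ε∈

  trivialOr∈ : ∀ I {i x} → i ∈ₛ I → TrivialOr i x → x ∈ Parabolic R₀ ρ I
  trivialOr∈ I i∈ (inj₁ eq) = trivial∈ I eq
  trivialOr∈ I {i} i∈ (inj₂ eq) = gen (i , i∈ , eq)

  -- Nested subsets are immediate. If I and J are disjoint, each index is omitted by one of them, so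
  -- all three predicates hold and x is trivial. Two different pairs share one index, and their two
  -- predicates leave only 1 and that generator.
  ∩-parabolic : ∀ I J x → x ∈ Parabolic R₀ ρ I → x ∈ Parabolic R₀ ρ J → x ∈ Parabolic R₀ ρ (I ∩ J)
  ∩-parabolic (true  ∷ true  ∷ true  ∷ []) (_ ∷ _ ∷ _ ∷ []) _ x∈ y∈ = y∈
  ∩-parabolic (false ∷ false ∷ false ∷ []) (_ ∷ _ ∷ _ ∷ []) _ x∈ y∈ = x∈
  ∩-parabolic (true  ∷ false ∷ false ∷ []) (true  ∷ _ ∷ _ ∷ []) _ x∈ y∈ = x∈
  ∩-parabolic (true  ∷ false ∷ false ∷ []) (false ∷ _ ∷ _ ∷ []) x x∈ y∈ =
    trivial∈ _ (Q₀₁∩Q₁₂∩Q₀₂ {x} (in₀₁ x∈) (in₁₂ y∈) (in₀₂ x∈))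
  ∩-parabolic (false ∷ true  ∷ false ∷ []) (_ ∷ true  ∷ _ ∷ []) _ x∈ y∈ = x∈
  ∩-parabolic (false ∷ true  ∷ false ∷ []) (_ ∷ false ∷ _ ∷ []) x x∈ y∈ =
    trivial∈ _ (Q₀₁∩Q₁₂∩Q₀₂ {x} (in₀₁ x∈) (in₁₂ x∈) (in₀₂ y∈))
  ∩-parabolic (false ∷ false ∷ true  ∷ []) (_ ∷ _ ∷ true  ∷ []) _ x∈ y∈ = x∈
  ∩-parabolic (false ∷ false ∷ true  ∷ []) (_ ∷ _ ∷ false ∷ []) x x∈ y∈ =
    trivial∈ _ (Q₀₁∩Q₁₂∩Q₀₂ {x} (in₀₁ y∈) (in₁₂ x∈) (in₀₂ x∈))
  ∩-parabolic (true  ∷ true  ∷ false ∷ []) (true  ∷ true  ∷ _ ∷ []) _ x∈ y∈ = x∈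
  ∩-parabolic (true  ∷ true  ∷ false ∷ []) (false ∷ false ∷ _ ∷ []) x x∈ y∈ =
    trivial∈ _ (Q₀₁∩Q₁₂∩Q₀₂ {x} (in₀₁ x∈) (in₁₂ y∈) (in₀₂ y∈))
  ∩-parabolic (true  ∷ true  ∷ false ∷ []) (true  ∷ false ∷ false ∷ []) _ x∈ y∈ = y∈
  ∩-parabolic (true  ∷ true  ∷ false ∷ []) (false ∷ true  ∷ false ∷ []) _ x∈ y∈ = y∈
  ∩-parabolic (true  ∷ true  ∷ false ∷ []) (true  ∷ false ∷ true  ∷ []) x x∈ y∈ =
    trivialOr∈ _ here (Q₀₁∩Q₀₂ {x} (in₀₁ x∈) (in₀₂ y∈))
  ∩-parabolic (true  ∷ true  ∷ false ∷ []) (false ∷ true  ∷ true  ∷ []) x x∈ y∈ =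
    trivialOr∈ _ (there here) (Q₀₁∩Q₁₂ {x} (in₀₁ x∈) (in₁₂ y∈))
  ∩-parabolic (true  ∷ false ∷ true  ∷ []) (true  ∷ _ ∷ true  ∷ []) _ x∈ y∈ = x∈
  ∩-parabolic (true  ∷ false ∷ true  ∷ []) (false ∷ _ ∷ false ∷ []) x x∈ y∈ =
    trivial∈ _ (Q₀₁∩Q₁₂∩Q₀₂ {x} (in₀₁ y∈) (in₁₂ y∈) (in₀₂ x∈))
  ∩-parabolic (true  ∷ false ∷ true  ∷ []) (true  ∷ false ∷ false ∷ []) _ x∈ y∈ = y∈
  ∩-parabolic (true  ∷ false ∷ true  ∷ []) (false ∷ false ∷ true  ∷ []) _ x∈ y∈ = y∈
  ∩-parabolic (true  ∷ false ∷ true  ∷ []) (true  ∷ true  ∷ false ∷ []) x x∈ y∈ =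
    trivialOr∈ _ here (Q₀₁∩Q₀₂ {x} (in₀₁ y∈) (in₀₂ x∈))
  ∩-parabolic (true  ∷ false ∷ true  ∷ []) (false ∷ true  ∷ true  ∷ []) x x∈ y∈ =
    trivialOr∈ _ (there (there here)) (Q₁₂∩Q₀₂ {x} (in₁₂ y∈) (in₀₂ x∈))
  ∩-parabolic (false ∷ true  ∷ true  ∷ []) (_ ∷ true  ∷ true  ∷ []) _ x∈ y∈ = x∈
  ∩-parabolic (false ∷ true  ∷ true  ∷ []) (_ ∷ false ∷ false ∷ []) x x∈ y∈ =
    trivial∈ _ (Q₀₁∩Q₁₂∩Q₀₂ {x} (in₀₁ y∈) (in₁₂ x∈) (in₀₂ y∈))
  ∩-parabolic (false ∷ true  ∷ true  ∷ []) (false ∷ true  ∷ false ∷ []) _ x∈ y∈ = y∈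
  ∩-parabolic (false ∷ true  ∷ true  ∷ []) (false ∷ false ∷ true  ∷ []) _ x∈ y∈ = y∈
  ∩-parabolic (false ∷ true  ∷ true  ∷ []) (true  ∷ true  ∷ false ∷ []) x x∈ y∈ =
    trivialOr∈ _ (there here) (Q₀₁∩Q₁₂ {x} (in₀₁ y∈) (in₁₂ x∈))
  ∩-parabolic (false ∷ true  ∷ true  ∷ []) (true  ∷ false ∷ true  ∷ []) x x∈ y∈ =
    trivialOr∈ _ (there (there here)) (Q₁₂∩Q₀₂ {x} (in₁₂ x∈) (in₀₂ y∈))

  parabolic-mono : ∀ {I J : Subset 3} → (∀ {i} → i ∈ₛ I → i ∈ₛ J) →
                   ∀ {x} → x ∈ Parabolic R₀ ρ I → x ∈ Parabolic R₀ ρ J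
  parabolic-mono I⊆J {x} = GroupLemmas.⟨⟩-mono R₀ (λ (i , i∈ , eq) → i , I⊆J i∈ , eq) {x}

  ρ-isStringCGroup : IsStringCGroup R₀ ρ
  ρ-isStringCGroup = record
    { involutions  = ρ-involution
    ; generates    = ρ-generates
    ; string       = ρ-string
    ; intersection = λ I J x → mk⇔
        (λ (x∈I , x∈J) → ∩-parabolic I J x x∈I x∈J)
        (λ x∈ → parabolic-mono (p∩q⊆p I J) {x} x∈ , parabolic-mono (p∩q⊆q I J) {x} x∈)
    }

  ρ-type : SchläfliType R₀ ρ (p ∷ 2 ℕ.* p ∷ [])
  ρ-type 0F = ρ₀ρ₁-order
  ρ-type 1F = ρ₁ρ₂-order

-- Generation of G by s₁ and β, and the theorem

module _ (n e r : ℕ) where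

  private
    module W where
      open Group (G (2+ n) e r) public
      open GroupOps rawGroup public

  Generated : Pred W.Carrier 0ℓ
  Generated = ⟨_⟩ (G (2+ n) e r) (λ y → (y W.≈ η (s fzero)) ⊎ (y W.≈ η β))

  commutator∈ : ∀ {x y} → x ∈ Generated → y ∈ Generated → W.[ x , y ] ∈ Generated
  commutator∈ x∈ y∈ = ∙∈ (∙∈ (∙∈ (⁻¹∈ x∈) (⁻¹∈ y∈)) x∈) y∈

  -- Each s_(k+1) is the commutator of s_k with β, so all the s_k are reached from s₁.
  s₁-β-generate : ∀ w → w ∈ Generated
  s₁-β-generate (η (s i)) = <-weakInduction (λ i → η (s i) ∈ Generated) (gen (inj₁ W.refl))
    (λ i s∈ → resp (W.sym (rel (s-next (inject₁ i) (fsuc i) (≡.cong suc (≡.sym (Fin.toℕ-inject₁ i))))))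
      (commutator∈ s∈ (gen (inj₂ W.refl)))) i
  s₁-β-generate (η β)     = gen (inj₂ W.refl)
  s₁-β-generate ε         = ε∈
  s₁-β-generate (v ∙ w)   = ∙∈ (s₁-β-generate v) (s₁-β-generate w)
  s₁-β-generate (w ⁻¹)    = ⁻¹∈ (s₁-β-generate w)

open import Data.Nat.Base using (_+_; _*_; _^_)

theorem1p1 : (p e r m : ℕ) (pp : Prime p) → p ≢ 2 → 1 ≤ e → 1 ≤ r → r ≤ p ∸ 1 →
    m ≡ e * r + (e ∸ 1) * (p ∸ r ∸ 1) + 1 → 3 ≤ m →
    (σ τ : Automorphism (G p e r)) → IsSigma {{prime⇒nonTrivial pp}} σ → IsTau {{prime⇒nonTrivial pp}} τ →
    GroupOrder (R p e r σ τ) (4 * p ^ m) ×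
    (∃[ ρ ] IsStringCGroup (R p e r σ τ) {3} ρ × SchläfliType (R p e r σ τ) ρ (p ∷ 2 * p ∷ []))
theorem1p1 0 _ _ _ pp = contradiction pp ¬prime[0]
theorem1p1 1 _ _ _ pp = contradiction pp ¬prime[1]
-- Once p is `2+ n`, `s₁` reduces to `η (s fzero)`, and the characters take their prescribed values
-- at s₁ and β by computation.
theorem1p1 p@(2+ n) e r m pp p≢2 1≤e 1≤r r<p m≡ _ σ τ (σs₁ , σβ) (τs₁ , τβ) =
  P.R-order (≡.subst (λ m → GroupOrder (G p e r) (p ^ m)) (≡.sym m≡) (order r<p)) ,
  P.ρ , P.ρ-isStringCGroup , P.ρ-type
  where
  open NormalForm n e r pp 1≤e 1≤r
  open Characters n e r pp 1≤e 1≤r using (χ; χ-homo)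
  module P = Polytope (G p e r) p pp p≢2 (η (s fzero)) (η β) (s₁-β-generate n e r) B-order [s₁β⁻¹]^p≈ε
    χ χ-homo (λ _ _ → ≡.refl) (λ _ _ → ≡.refl) σ τ σs₁ σβ τs₁ τβ
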